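{- Let $P_{(1,1,0,0)}$ be the set of all cylindric partitions with profile $c=(1,1,0,0)$. Then, as formal power series in $q$, $$\sum_{\Lambda\in P_{(1,1,0,0)}} q^{|\Lambda|}=\left(\sum_{n\ge0}\frac{q^{n^2}}{(q^2;q^2)_n}\right)\frac{(-q^2;q^2)_\infty}{(q;q)_\infty}.$$
   Context: Let $r,\ell$ be positive integers and $c=(c_1,\dots,c_r)$ a composition of $\ell$ into $r$ nonnegative integer parts (zero entries allowed). A cylindric partition with profile $c$ is a tuple $\Lambda=(\lambda^{(1)},\dots,\lambda^{(r)})$ of ordinary partitions $\lambda^{(i)}=(\lambda^{(i)}_1\ge\lambda^{(i)}_2\ge\cdots)$ (parts beyond the length are taken to be $0$) such that for all $i,j$: $\lambda^{(i)}_j\ge\lambda^{(i+1)}_{j+c_{i+1}}$ for $1\le i\le r-1$, and $\lambda^{(r)}_j\ge\lambda^{(1)}_{j+c_1}$. The size $|\Lambda|$ is the sum of all parts of all $\lambda^{(i)}$; the empty cylindric partition is included with size $0$. Notation: $(a;q)_n=\prod_{k=1}^n(1-aq^{k-1})$, $(a;q)_\infty=\lim_{n\to\infty}(a;q)_n$. -}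

module Defs where

open import Data.Nat using (ℕ; zero; suc; _+_; _*_; _∸_; _≥_; _<_; NonZero)
open import Data.Nat.DivMod using (_mod_)
open import Data.Fin using (Fin; toℕ)
open import Data.List using (List; []; _∷_; map; upTo; length)
open import Data.Nat.ListAction using (sum)
open import Data.List.Relation.Unary.All using (All)
open import Data.List.Relation.Unary.Linked using (Linked)
open import Data.Vec using (Vec; lookup; toList)
import Data.Vec
import Data.Nat
import Relation.Nullary
open import Data.Product using (_×_)

IsPartition : List ℕ → Set
IsPartition xs = Linked _≥_ xs × All (λ x → 0 < x) xs

-- part λ k = λ_{k+1}  (0-based index), with default 0 beyond the length.
part : List ℕ → ℕ → ℕ
part []       _       = 0
part (x ∷ xs) zero    = x
part (x ∷ xs) (suc k) = part xs k

next : ∀ {r} .{{_ : NonZero r}} → Fin r → Fin r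
next {r} i = suc (toℕ i) mod r

-- Λ = (λ^(1),…,λ^(r)) is a cylindric partition with profile c:
-- every component is a partition, and for every i (cyclically, i+1 taken
-- mod r) and every j ≥ 1:  λ^(i)_j ≥ λ^(i+1)_{j + c_{i+1}}.
-- (Written with 0-based j.)
record IsCylindric {r : ℕ} .{{_ : NonZero r}} (c : Vec ℕ r) (Λ : Vec (List ℕ) r) : Set where
  field
    partitions : ∀ i → IsPartition (lookup Λ i)
    interlace  : ∀ i j →
      part (lookup Λ i) j ≥ part (lookup Λ (next i)) (j + lookup c (next i))

size : ∀ {r} → Vec (List ℕ) r → ℕ
size Λ = sum (map sum (toList Λ))

-- Formal power series with ℕ coefficients, as coefficient functions.

PS : Set
PS = ℕ → ℕ

_⊛_ : PS → PS → PS
(f ⊛ g) N = sum (map (λ i → f i * g (N ∸ i)) (upTo (suc N)))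

oneS : PS
oneS zero    = 1
oneS (suc _) = 0

mono : ℕ → PS
mono k N with k Data.Nat.≟ N
... | Relation.Nullary.yes _ = 1
... | Relation.Nullary.no  _ = 0

onePlus : ℕ → PS
onePlus k N = oneS N + mono k N

-- 1/(1 - q^k) = Σ_{m ≥ 0} q^{k m}   (k ≥ 1): coefficient of q^N is 1
-- iff N is a multiple of k.
geomInv : ℕ → PS
geomInv k N = sum (map (λ m → mono (k * m) N) (upTo (suc N)))

prodTo : ℕ → (ℕ → PS) → PS
prodTo zero    f = oneS
prodTo (suc n) f = prodTo n f ⊛ f (suc n)

-- infinite product ∏_{k≥1} f k, valid when f k ≡ 1 mod q^k (as for
-- 1 + q^{2k} and 1/(1-q^k)): the coefficient of q^N only depends on the
-- factors with k ≤ N.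
prodInf : (ℕ → PS) → PS
prodInf f N = prodTo N f N

-- infinite sum Σ_{n≥0} g n, valid when g n ≡ 0 mod q^{n}·(…) i.e. g n has
-- no terms below q^n (as for q^{n²}/(q²;q²)_n): coefficient of q^N only
-- depends on n ≤ N.
sumInf : (ℕ → PS) → PS
sumInf g N = sum (map (λ n → g n N) (upTo (suc N)))

invPoch : ℕ → ℕ → PS
invPoch s n = prodTo n (λ k → geomInv (s * k))

invPochInf : PS
invPochInf = prodInf (λ k → geomInv k)

negPochInf : PS
negPochInf = prodInf (λ k → onePlus (2 * k))

rrSum : PS
rrSum = sumInf (λ n → mono (n * n) ⊛ invPoch 2 n)

rhs56 : PS
rhs56 = rrSum ⊛ (negPochInf ⊛ invPochInf)

profile1100 : Vec ℕ 4
profile1100 = 1 Data.Vec.∷ 1 Data.Vec.∷ 0 Data.Vec.∷ 0 Data.Vec.∷ Data.Vec.[]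

{-# OPTIONS --safe #-}
module Submission where

-- Bound the entries by n and peel off the entries equal to n one at a time: removing a leading n
-- from a component moves a unit of the profile to the next position. Up to rotation only the
-- profiles (2,0,0,0), (1,1,0,0), (1,0,1,0) occur, and with x = q^n their series satisfy
--   U_n = U_{n-1} + x V_n,   V_n + x² V_n = V_{n-1} + x (U_n + W_n),   W_n + x² W_n = W_{n-1} + 2x V_n.
-- A Bailey-type transform (B f)_n = ∑_{j+m=n} q^{j²} f_j / (q;q)_m preserves relations of the shape
-- f_j + q^{2j} f_j = f_{j-1} + q^j h_j, and applying it twice to 1/(q²;q²)_k solves the system:
-- V = B u with u = B (q^k/(q²;q²)_k). As n → ∞ this gives V = (q;q)_∞^{-1} ∑_j q^{j²} u_j.
-- The last sum is the value at t = 0 of a family with Λ(t) = (1 + q^{t+1}) Λ(t+1), and so is the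
-- product of the Euler sums A(t) A(t+1), A(t) = ∑_n q^{n²+tn}/(q²;q²)_n; here A(0) is the sum in
-- the statement and A(1) = (-q²;q²)_∞.
-- Every identity is stated without subtraction, in ℕ[[q]], and terms are cancelled coefficientwise.

open import Defs
open import Data.Nat
open import Data.Nat.Properties
open import Data.Nat.Tactic.RingSolver using (solve-∀)
open import Data.Nat.ListAction using (sum)
open import Data.Fin using (zero; suc)
open import Data.Product using (Σ; ∃; _×_; _,_; proj₁; proj₂)
open import Data.Sum using (_⊎_; inj₁; inj₂; [_,_]′)
open import Data.List using (List; []; _∷_; map; _++_; length; upTo; applyUpTo)
open import Data.List.Properties using (map-applyUpTo; length-map; length-++)
open import Data.List.Relation.Unary.All as All using (All; []; _∷_)
open import Data.List.Relation.Unary.AllPairs using ([]; _∷_)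
open import Data.List.Relation.Unary.Any using (here)
open import Data.List.Relation.Unary.Linked using (Linked; []; [-]; _∷_)
open import Data.List.Relation.Unary.Unique.Propositional using (Unique)
import Data.List.Relation.Unary.Unique.Propositional.Properties as Unique
open import Data.List.Membership.Propositional using (_∈_)
open import Data.List.Membership.Propositional.Properties
  using (∈-map⁺; ∈-map⁻; ∈-++⁺ˡ; ∈-++⁺ʳ; ∈-++⁻)
open import Data.Vec using (Vec; []; _∷_)
open import Function using (flip; id; _∘_)
open import Relation.Nullary using (¬_; yes; no)
open import Relation.Nullary.Negation using (contradiction)
open import Relation.Binary.PropositionalEquality
open ≡-Reasoning

-- Formal power series

-- ∑ F i j over i + j = n.
diag : ℕ → (ℕ → ℕ → ℕ) → ℕ
diag zero    F = F 0 0
diag (suc n) F = F 0 (suc n) + diag n (λ i j → F (suc i) j)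

diag-cong : ∀ n {F G : ℕ → ℕ → ℕ} → (∀ i j → F i j ≡ G i j) → diag n F ≡ diag n G
diag-cong zero    p = p 0 0
diag-cong (suc n) p = cong₂ _+_ (p 0 (suc n)) (diag-cong n (λ i j → p (suc i) j))

diag-cong-on : ∀ n {F G : ℕ → ℕ → ℕ} → (∀ i j → i + j ≡ n → F i j ≡ G i j) → diag n F ≡ diag n G
diag-cong-on zero    p = p 0 0 refl
diag-cong-on (suc n) p =
  cong₂ _+_ (p 0 (suc n) refl) (diag-cong-on n (λ i j e → p (suc i) j (cong suc e)))

-- On the diagonal the total may be replaced by `i + j`, which turns exponents into polynomials in
-- the indices that the ring solver can compare.
diag-total : ∀ n (H : ℕ → ℕ → ℕ → ℕ) → diag n (H n) ≡ diag n (λ i j → H (i + j) i j)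
diag-total n H = diag-cong-on n (λ i j e → cong (λ k → H k i j) (sym e))

diag-0 : ∀ n → diag n (λ _ _ → 0) ≡ 0
diag-0 zero    = refl
diag-0 (suc n) = diag-0 n

diag-+ : ∀ n (F G : ℕ → ℕ → ℕ) → diag n (λ i j → F i j + G i j) ≡ diag n F + diag n G
diag-+ zero    F G = refl
diag-+ (suc n) F G = trans
  (cong (F 0 (suc n) + G 0 (suc n) +_) (diag-+ n (λ i → F (suc i)) (λ i → G (suc i))))
  (rearr (F 0 (suc n)) (G 0 (suc n)) _ _)
  where
  rearr : ∀ a b c d → (a + b) + (c + d) ≡ (a + c) + (b + d)
  rearr = solve-∀

*-diag : ∀ n c (F : ℕ → ℕ → ℕ) → c * diag n F ≡ diag n (λ i j → c * F i j)
*-diag zero    c F = refl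
*-diag (suc n) c F = trans (*-distribˡ-+ c (F 0 (suc n)) _)
  (cong (c * F 0 (suc n) +_) (*-diag n c (λ i → F (suc i))))

diag-last : ∀ n (F : ℕ → ℕ → ℕ) → diag (suc n) F ≡ diag n (λ i j → F i (suc j)) + F (suc n) 0
diag-last zero    F = refl
diag-last (suc n) F = trans
  (cong (F 0 (suc (suc n)) +_) (diag-last n (λ i → F (suc i))))
  (sym (+-assoc (F 0 (suc (suc n))) _ _))

diag-flip : ∀ n (F : ℕ → ℕ → ℕ) → diag n F ≡ diag n (flip F)
diag-flip zero    F = refl
diag-flip (suc n) F = begin
  F 0 (suc n) + diag n (λ i j → F (suc i) j)  ≡⟨ +-comm (F 0 (suc n)) _ ⟩
  diag n (λ i j → F (suc i) j) + F 0 (suc n)  ≡⟨ cong (_+ F 0 (suc n)) (diag-flip n (λ i j → F (suc i) j)) ⟩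
  diag n (λ i j → F (suc j) i) + F 0 (suc n)  ≡⟨ diag-last n (flip F) ⟨
  diag (suc n) (flip F)                       ∎

diag-swap : ∀ n m (F : ℕ → ℕ → ℕ → ℕ → ℕ) →
  diag n (λ i j → diag m (F i j)) ≡ diag m (λ a b → diag n (λ i j → F i j a b))
diag-swap zero    m F = refl
diag-swap (suc n) m F = trans
  (cong (diag m (F 0 (suc n)) +_) (diag-swap n m (λ i → F (suc i))))
  (sym (diag-+ m (F 0 (suc n)) _))

diag-assoc : ∀ n (F : ℕ → ℕ → ℕ → ℕ) →
  diag n (λ i k → diag i (λ a b → F a b k)) ≡ diag n (λ a j → diag j (λ b k → F a b k))
diag-assoc zero    F = refl
diag-assoc (suc n) F = begin
  F 0 0 (suc n) + diag n (λ i k → F 0 (suc i) k + diag i (λ a b → F (suc a) b k))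
    ≡⟨ cong (F 0 0 (suc n) +_) (diag-+ n (λ i k → F 0 (suc i) k) _) ⟩
  F 0 0 (suc n) + (diag n (λ i k → F 0 (suc i) k) + diag n (λ i k → diag i (λ a b → F (suc a) b k)))
    ≡⟨ +-assoc (F 0 0 (suc n)) _ _ ⟨
  diag (suc n) (F 0) + diag n (λ i k → diag i (λ a b → F (suc a) b k))
    ≡⟨ cong (diag (suc n) (F 0) +_) (diag-assoc n (λ a → F (suc a))) ⟩
  diag (suc n) (F 0) + diag n (λ a j → diag j (λ b k → F (suc a) b k)) ∎

sum-upTo : ∀ n (h : ℕ → ℕ) → sum (map h (upTo (suc n))) ≡ diag n (λ i _ → h i)
sum-upTo n h = trans (cong sum (map-applyUpTo id h (suc n))) (go n h)
  where
  go : ∀ n (h : ℕ → ℕ) → sum (applyUpTo h (suc n)) ≡ diag n (λ i _ → h i)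
  go zero    h = +-identityʳ (h 0)
  go (suc n) h = cong (h 0 +_) (go n (h ∘ suc))

infixl 6 _⊕_
infixl 7 _∙_
infixr 8 _↑_

_⊕_ : PS → PS → PS
(f ⊕ g) N = f N + g N

zeroS : PS
zeroS _ = 0

-- The Cauchy product, in a form that computes by recursion on the coefficient.
_∙_ : PS → PS → PS
(f ∙ g) N = diag N (λ i j → f i * g j)

-- k ↑ f is q^k f.
_↑_ : ℕ → PS → PS
(zero  ↑ f) N       = f N
(suc k ↑ f) zero    = 0
(suc k ↑ f) (suc N) = (k ↑ f) N

⊛≗∙ : ∀ f g → f ⊛ g ≗ f ∙ g
⊛≗∙ f g N = begin
  sum (map (λ i → f i * g (N ∸ i)) (upTo (suc N)))  ≡⟨ sum-upTo N _ ⟩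
  diag N (λ i _ → f i * g (N ∸ i))                  ≡⟨ diag-total N (λ N i _ → f i * g (N ∸ i)) ⟩
  diag N (λ i j → f i * g (i + j ∸ i))
    ≡⟨ diag-cong N (λ i j → cong (λ k → f i * g k) (m+n∸m≡n i j)) ⟩
  diag N (λ i j → f i * g j)                        ∎

∙-cong : ∀ {f f′ g g′} → f ≗ f′ → g ≗ g′ → f ∙ g ≗ f′ ∙ g′
∙-cong p q N = diag-cong N (λ i j → cong₂ _*_ (p i) (q j))

∙-congˡ : ∀ f {g g′} → g ≗ g′ → f ∙ g ≗ f ∙ g′
∙-congˡ f = ∙-cong {f} (λ _ → refl)

∙-congʳ : ∀ {f f′} g → f ≗ f′ → f ∙ g ≗ f′ ∙ g
∙-congʳ g p = ∙-cong {g = g} p (λ _ → refl)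

∙-comm : ∀ f g → f ∙ g ≗ g ∙ f
∙-comm f g N = trans (diag-flip N _) (diag-cong N (λ i j → *-comm (f j) (g i)))

∙-assoc : ∀ f g h → (f ∙ g) ∙ h ≗ f ∙ (g ∙ h)
∙-assoc f g h N = begin
  diag N (λ i k → diag i (λ a b → f a * g b) * h k)
    ≡⟨ diag-cong N (λ i k → trans (*-comm _ (h k)) (*-diag i (h k) _)) ⟩
  diag N (λ i k → diag i (λ a b → h k * (f a * g b)))
    ≡⟨ diag-assoc N (λ a b k → h k * (f a * g b)) ⟩
  diag N (λ a j → diag j (λ b k → h k * (f a * g b)))
    ≡⟨ diag-cong N (λ a j → trans (diag-cong j (λ b k → rearr (h k) (f a) (g b))) (sym (*-diag j (f a) _))) ⟩
  diag N (λ a j → f a * diag j (λ b k → g b * h k)) ∎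
  where
  rearr : ∀ x y z → x * (y * z) ≡ y * (z * x)
  rearr = solve-∀

∙-⊕ʳ : ∀ f g h → f ∙ (g ⊕ h) ≗ (f ∙ g) ⊕ (f ∙ h)
∙-⊕ʳ f g h N = trans (diag-cong N (λ i j → *-distribˡ-+ (f i) (g j) (h j))) (diag-+ N _ _)

∙-⊕ˡ : ∀ f g h → (f ⊕ g) ∙ h ≗ (f ∙ h) ⊕ (g ∙ h)
∙-⊕ˡ f g h N = trans (diag-cong N (λ i j → *-distribʳ-+ (h j) (f i) (g i))) (diag-+ N _ _)

∙-zeroˡ : ∀ f → zeroS ∙ f ≗ zeroS
∙-zeroˡ f N = diag-0 N

∙-zeroʳ : ∀ f → f ∙ zeroS ≗ zeroS
∙-zeroʳ f N = trans (∙-comm f zeroS N) (∙-zeroˡ f N)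

∙-identityˡ : ∀ f → oneS ∙ f ≗ f
∙-identityˡ f zero    = +-identityʳ (f 0)
∙-identityˡ f (suc N) = trans (cong₂ _+_ (+-identityʳ (f (suc N))) (diag-0 N)) (+-identityʳ (f (suc N)))

∙-identityʳ : ∀ f → f ∙ oneS ≗ f
∙-identityʳ f N = trans (∙-comm f oneS N) (∙-identityˡ f N)

↑-cong : ∀ k {f g} → f ≗ g → k ↑ f ≗ k ↑ g
↑-cong zero    p N       = p N
↑-cong (suc k) p zero    = refl
↑-cong (suc k) p (suc N) = ↑-cong k p N

↑-cong-on : ∀ k N {f g} → (∀ M → k + M ≡ N → f M ≡ g M) → (k ↑ f) N ≡ (k ↑ g) N
↑-cong-on zero    N       p = p N refl
↑-cong-on (suc k) zero    p = refl
↑-cong-on (suc k) (suc N) p = ↑-cong-on k N (λ M e → p M (cong suc e))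

↑-exp : ∀ {k l} f N → k ≡ l → (k ↑ f) N ≡ (l ↑ f) N
↑-exp f N refl = refl

↑-↑ : ∀ k l f → k ↑ l ↑ f ≗ (k + l) ↑ f
↑-↑ zero    l f N       = refl
↑-↑ (suc k) l f zero    = refl
↑-↑ (suc k) l f (suc N) = ↑-↑ k l f N

↑-⊕ : ∀ k f g → k ↑ (f ⊕ g) ≗ (k ↑ f) ⊕ (k ↑ g)
↑-⊕ zero    f g N       = refl
↑-⊕ (suc k) f g zero    = refl
↑-⊕ (suc k) f g (suc N) = ↑-⊕ k f g N

↑-zero : ∀ k → k ↑ zeroS ≗ zeroS
↑-zero zero    N       = refl
↑-zero (suc k) zero    = refl
↑-zero (suc k) (suc N) = ↑-zero k N

↑-below : ∀ k f N → N < k → (k ↑ f) N ≡ 0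
↑-below (suc k) f zero    p       = refl
↑-below (suc k) f (suc N) (s≤s p) = ↑-below k f N p

↑-diag : ∀ k n (F : ℕ → ℕ → PS) N →
  (k ↑ (λ M → diag n (λ i j → F i j M))) N ≡ diag n (λ i j → (k ↑ F i j) N)
↑-diag zero    n F N       = refl
↑-diag (suc k) n F zero    = sym (diag-0 n)
↑-diag (suc k) n F (suc N) = ↑-diag k n F N

↑-∙ˡ : ∀ k f g → (k ↑ f) ∙ g ≗ k ↑ (f ∙ g)
↑-∙ˡ zero    f g N       = refl
↑-∙ˡ (suc k) f g zero    = refl
↑-∙ˡ (suc k) f g (suc N) = ↑-∙ˡ k f g N

↑-∙ʳ : ∀ k f g → f ∙ (k ↑ g) ≗ k ↑ (f ∙ g)
↑-∙ʳ k f g N = begin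
  (f ∙ (k ↑ g)) N  ≡⟨ ∙-comm f (k ↑ g) N ⟩
  ((k ↑ g) ∙ f) N  ≡⟨ ↑-∙ˡ k g f N ⟩
  (k ↑ (g ∙ f)) N  ≡⟨ ↑-cong k (∙-comm g f) N ⟩
  (k ↑ (f ∙ g)) N  ∎

-- Normal form `q^E c f` of a summand: with all powers of q collected in front, comparing summands
-- reduces to comparing exponents.
term : ℕ → PS → PS → PS
term E c f = E ↑ (c ∙ f)

term-⊕ʳ : ∀ E c f g → term E c (f ⊕ g) ≗ term E c f ⊕ term E c g
term-⊕ʳ E c f g N = trans (↑-cong E (∙-⊕ʳ c f g) N) (↑-⊕ E (c ∙ f) (c ∙ g) N)

term-⊕ˡ : ∀ E c d f → term E (c ⊕ d) f ≗ term E c f ⊕ term E d f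
term-⊕ˡ E c d f N = trans (↑-cong E (∙-⊕ˡ c d f) N) (↑-⊕ E (c ∙ f) (d ∙ f) N)

term-congˡ : ∀ E c {f g} → f ≗ g → term E c f ≗ term E c g
term-congˡ E c p = ↑-cong E (∙-congˡ c p)

term-congʳ : ∀ E f {c d} → c ≗ d → term E c f ≗ term E d f
term-congʳ E f p = ↑-cong E (∙-congʳ f p)

term-↑ʳ : ∀ E k c f → term E c (k ↑ f) ≗ term (E + k) c f
term-↑ʳ E k c f N = trans (↑-cong E (↑-∙ʳ k c f) N) (↑-↑ E k (c ∙ f) N)

term-↑ˡ : ∀ E k c f → term E (k ↑ c) f ≗ term (E + k) c f
term-↑ˡ E k c f N = trans (↑-cong E (↑-∙ˡ k c f) N) (↑-↑ E k (c ∙ f) N)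

term-exp : ∀ {E E′} c f N → E ≡ E′ → term E c f N ≡ term E′ c f N
term-exp c f = ↑-exp (c ∙ f)

term-zeroˡ : ∀ E f → term E zeroS f ≗ zeroS
term-zeroˡ E f N = trans (↑-cong E (∙-zeroˡ f) N) (↑-zero E N)

term-zeroʳ : ∀ E c → term E c zeroS ≗ zeroS
term-zeroʳ E c N = trans (↑-cong E (∙-zeroʳ c) N) (↑-zero E N)

prev : (ℕ → PS) → ℕ → PS
prev f zero    = zeroS
prev f (suc n) = f n

mono≗↑ : ∀ k → mono k ≗ k ↑ oneS
mono≗↑ k N with k ≟ N
mono≗↑ k N | yes p = sym (on k N p)
  where
  on : ∀ k N → k ≡ N → (k ↑ oneS) N ≡ 1
  on zero    .zero    refl = refl
  on (suc k) .(suc k) refl = on k k refl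
mono≗↑ k N | no  p = sym (off k N p)
  where
  off : ∀ k N → k ≢ N → (k ↑ oneS) N ≡ 0
  off zero    zero    p = contradiction refl p
  off zero    (suc N) p = refl
  off (suc k) zero    p = refl
  off (suc k) (suc N) p = off k N (p ∘ cong suc)

-- Infinite sums of power series

diag-extend : ∀ N d (h : ℕ → ℕ) → (∀ n → N < n → h n ≡ 0) →
  diag (d + N) (λ n _ → h n) ≡ diag N (λ n _ → h n)
diag-extend N zero    h p = refl
diag-extend N (suc d) h p = begin
  diag (suc (d + N)) (λ n _ → h n)              ≡⟨ diag-last (d + N) (λ n _ → h n) ⟩
  diag (d + N) (λ n _ → h n) + h (suc (d + N))
    ≡⟨ cong₂ _+_ (diag-extend N d h p) (p _ (s≤s (m≤n+m N d))) ⟩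
  diag N (λ n _ → h n) + 0                      ≡⟨ +-identityʳ _ ⟩
  diag N (λ n _ → h n)                          ∎

Vanishing : (ℕ → PS) → Set
Vanishing g = ∀ n N → N < n → g n N ≡ 0

-- Meaningful only for Vanishing g: the coefficient of q^N ignores all g n with n > N.
∑ : (ℕ → PS) → PS
∑ g N = diag N (λ n _ → g n N)

∑-cong : ∀ {g h} → (∀ n → g n ≗ h n) → ∑ g ≗ ∑ h
∑-cong p N = diag-cong N (λ n _ → p n N)

∑-⊕ : ∀ g h → ∑ (λ n → g n ⊕ h n) ≗ ∑ g ⊕ ∑ h
∑-⊕ g h N = diag-+ N _ _

-- Allows one common truncation for all the coefficients that a shift or a product combines.
∑-extend : ∀ {g} → Vanishing g → ∀ {N K} → N ≤ K → diag K (λ n _ → g n N) ≡ ∑ g N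
∑-extend {g} v {N} {K} p = trans (cong (λ k → diag k (λ n _ → g n N)) (sym (m∸n+n≡m p)))
  (diag-extend N (K ∸ N) (λ n → g n N) (λ n → v n N))

∑-↑ : ∀ k {g} → Vanishing g → ∑ (λ n → k ↑ g n) ≗ k ↑ ∑ g
∑-↑ k {g} v N = sym (begin
  (k ↑ ∑ g) N                              ≡⟨ ↑-cong-on k N (λ M e →
                                                sym (∑-extend v (subst (M ≤_) e (m≤n+m M k)))) ⟩
  (k ↑ (λ M → diag N (λ n _ → g n M))) N   ≡⟨ ↑-diag k N (λ n _ → g n) N ⟩
  diag N (λ n _ → (k ↑ g n) N)             ∎)

∑-∙ : ∀ c {g} → Vanishing g → ∑ (λ n → c ∙ g n) ≗ c ∙ ∑ g
∑-∙ c {g} v N = sym (begin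
  diag N (λ i j → c i * ∑ g j)
    ≡⟨ diag-cong-on N (λ i j e → cong (c i *_) (sym (∑-extend v (subst (j ≤_) e (m≤n+m j i))))) ⟩
  diag N (λ i j → c i * diag N (λ n _ → g n j))       ≡⟨ diag-cong N (λ i j → *-diag N (c i) _) ⟩
  diag N (λ i j → diag N (λ n _ → c i * g n j))       ≡⟨ diag-swap N N _ ⟩
  diag N (λ n _ → diag N (λ i j → c i * g n j))       ∎)

↑-vanishing : ∀ (E : ℕ → ℕ) (g : ℕ → PS) → (∀ n → n ≤ E n) → Vanishing (λ n → E n ↑ g n)
↑-vanishing E g p n N q = ↑-below (E n) (g n) N (≤-trans q (p n))

-- After reindexing, the coefficient of q^N gains the summand `n = N`, which vanishes there because
-- its exponent `E (suc N)` exceeds N.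
∑-prev : ∀ (E : ℕ → ℕ) (g : ℕ → PS) → (∀ n → n ≤ E n) →
  ∑ (λ n → E n ↑ prev g n) ≗ ∑ (λ n → E (suc n) ↑ g n)
∑-prev E g p zero    = trans (↑-zero (E 0) 0) (sym (↑-below (E 1) (g 0) 0 (p 1)))
∑-prev E g p (suc N) = begin
  (E 0 ↑ zeroS) (suc N) + diag N (λ n _ → (E (suc n) ↑ g n) (suc N))
    ≡⟨ cong (_+ S) (↑-zero (E 0) (suc N)) ⟩
  S                                              ≡⟨ +-identityʳ S ⟨
  S + 0                                          ≡⟨ cong (S +_) (↑-below (E (suc (suc N))) (g (suc N)) (suc N) (p _)) ⟨
  S + (E (suc (suc N)) ↑ g (suc N)) (suc N)      ≡⟨ diag-last N (λ n _ → (E (suc n) ↑ g n) (suc N)) ⟨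
  ∑ (λ n → E (suc n) ↑ g n) (suc N)              ∎
  where S = diag N (λ n _ → (E (suc n) ↑ g n) (suc N))

-- Geometric series and reciprocals of q-factorials

geomInv-rec : ∀ k → geomInv (suc k) ≗ oneS ⊕ (suc k ↑ geomInv (suc k))
geomInv-rec k N = begin
  geomInv (suc k) N                              ≡⟨ toSum N ⟩
  ∑ (λ m → (suc k * m) ↑ oneS) N                 ≡⟨ first N ⟩
  (oneS ⊕ ∑ (λ m → (suc k * suc m) ↑ oneS)) N
    ≡⟨ cong (oneS N +_) (∑-cong (λ m M → trans (↑-exp oneS M (*-suc (suc k) m))
                                           (sym (↑-↑ (suc k) (suc k * m) oneS M))) N) ⟩
  (oneS ⊕ ∑ (λ m → suc k ↑ (suc k * m) ↑ oneS)) N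
    ≡⟨ cong (oneS N +_) (∑-↑ (suc k) (↑-vanishing (suc k *_) _ (λ m → m≤n*m m (suc k))) N) ⟩
  (oneS ⊕ suc k ↑ ∑ (λ m → (suc k * m) ↑ oneS)) N
    ≡⟨ cong (oneS N +_) (↑-cong (suc k) (sym ∘ toSum) N) ⟩
  (oneS ⊕ (suc k ↑ geomInv (suc k))) N           ∎
  where
  toSum : geomInv (suc k) ≗ ∑ (λ m → (suc k * m) ↑ oneS)
  toSum N = trans (sum-upTo N _) (diag-cong N (λ m _ → mono≗↑ (suc k * m) N))
  first : ∑ (λ m → (suc k * m) ↑ oneS) ≗ oneS ⊕ ∑ (λ m → (suc k * suc m) ↑ oneS)
  first zero    rewrite *-zeroʳ k = refl
  first (suc N) = begin
    ((suc k * 0) ↑ oneS) (suc N) + S   ≡⟨ cong (_+ S) (↑-exp oneS (suc N) (*-zeroʳ (suc k))) ⟩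
    S                                  ≡⟨ +-identityʳ S ⟨
    S + 0
      ≡⟨ cong (S +_) (↑-below (suc k * suc (suc N)) oneS (suc N) (m≤n*m (suc (suc N)) (suc k))) ⟨
    S + ((suc k * suc (suc N)) ↑ oneS) (suc N)
      ≡⟨ diag-last N (λ m _ → ((suc k * suc m) ↑ oneS) (suc N)) ⟨
    ∑ (λ m → (suc k * suc m) ↑ oneS) (suc N) ∎
    where S = diag N (λ m _ → ((suc k * suc m) ↑ oneS) (suc N))

-- Subtraction-free form of `(1 - q^{E n}) p_n = p_{n-1}`. At `n = 0` it reads `p_0 = 0 + q^0 p_0`,
-- hence the condition `E 0 ≡ 0`.
prodTo-geomInv-rec : ∀ (E : ℕ → ℕ) → E 0 ≡ 0 → (∀ n → NonZero (E (suc n))) → ∀ n →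
  let p = λ n → prodTo n (λ k → geomInv (E k)) in p n ≗ prev p n ⊕ (E n ↑ p n)
prodTo-geomInv-rec E e0 nz zero    N = sym (↑-exp oneS N e0)
prodTo-geomInv-rec E e0 nz (suc n) N with E (suc n) | nz n
... | suc k | _ = begin
  (p ⊛ g) N                              ≡⟨ ⊛≗∙ p g N ⟩
  (p ∙ g) N                              ≡⟨ ∙-congˡ p (geomInv-rec k) N ⟩
  (p ∙ (oneS ⊕ suc k ↑ g)) N             ≡⟨ ∙-⊕ʳ p oneS _ N ⟩
  (p ∙ oneS) N + (p ∙ (suc k ↑ g)) N
    ≡⟨ cong₂ _+_ (∙-identityʳ p N) (trans (↑-∙ʳ (suc k) p g N) (↑-cong (suc k) (sym ∘ ⊛≗∙ p g) N)) ⟩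
  p N + (suc k ↑ (p ⊛ g)) N              ∎
  where p = prodTo n (λ k → geomInv (E k))
        g = geomInv (suc k)

-- c m = 1/(q;q)_m and e k = 1/(q²;q²)_k.
c e : ℕ → PS
c m = prodTo m geomInv
e   = invPoch 2

c-rec : ∀ m → c m ≗ prev c m ⊕ m ↑ c m
c-rec = prodTo-geomInv-rec id refl (λ n → _)

e-rec : ∀ k → e k ≗ prev e k ⊕ (2 * k) ↑ e k
e-rec = prodTo-geomInv-rec (2 *_) refl (λ n → _)

term-c : ∀ E m f → term E (c m) f ≗ term E (prev c m) f ⊕ term (E + m) (c m) f
term-c E m f N = begin
  term E (c m) f N                              ≡⟨ term-congʳ E f (c-rec m) N ⟩
  term E (prev c m ⊕ m ↑ c m) f N               ≡⟨ term-⊕ˡ E (prev c m) (m ↑ c m) f N ⟩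
  term E (prev c m) f N + term E (m ↑ c m) f N  ≡⟨ cong (term E (prev c m) f N +_) (term-↑ˡ E m (c m) f N) ⟩
  term E (prev c m) f N + term (E + m) (c m) f N ∎

-- The Bailey transform

-- The map on the β-side of the Bailey lemma with a = 1 and both parameters sent to infinity.
B : (ℕ → PS) → ℕ → PS
B f n N = diag n (λ j m → term (j * j) (c m) (f j) N)

B-cong : ∀ {f g} → (∀ j → f j ≗ g j) → ∀ n → B f n ≗ B g n
B-cong p n N = diag-cong n (λ j m → term-congˡ (j * j) (c m) (p j) N)

B-⊕ : ∀ f g n → B (λ j → f j ⊕ g j) n ≗ B f n ⊕ B g n
B-⊕ f g n N = trans (diag-cong n (λ j m → term-⊕ʳ (j * j) (c m) (f j) (g j) N)) (diag-+ n _ _)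

-- Lowering `m` loses only the boundary summand `m = 0`, where `prev c` is zero. In `diag-prev-f`
-- the same happens to `j`.
diag-prev-c : ∀ (E : ℕ → ℕ → ℕ) (f : ℕ → PS) n N →
  diag (suc n) (λ j m → term (E j m) (prev c m) (f j) N) ≡
  diag n (λ j m → term (E j (suc m)) (c m) (f j) N)
diag-prev-c E f n N = trans (diag-last n (λ j m → term (E j m) (prev c m) (f j) N))
  (trans (cong (diag n (λ j m → term (E j (suc m)) (c m) (f j) N) +_) (term-zeroˡ (E (suc n) 0) (f (suc n)) N))
         (+-identityʳ _))

diag-prev-f : ∀ (E : ℕ → ℕ → ℕ) (f : ℕ → PS) n N →
  diag (suc n) (λ j m → term (E j m) (c m) (prev f j) N) ≡
  diag n (λ j m → term (E (suc j) m) (c m) (f j) N)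
diag-prev-f E f n N = cong (_+ diag n (λ j m → term (E (suc j) m) (c m) (f j) N))
  (term-zeroʳ (E 0 (suc n)) (c (suc n)) N)

diag-prev-B : ∀ f n N → diag n (λ j m → term (j * j) (prev c m) (f j) N) ≡ prev (B f) n N
diag-prev-B f zero    N = term-zeroˡ 0 (f 0) N
diag-prev-B f (suc n) N = diag-prev-c (λ j _ → j * j) f n N

↑-B : ∀ (E : ℕ → ℕ) f n N →
  (E n ↑ B f n) N ≡ diag n (λ j m → term (E (j + m) + j * j) (c m) (f j) N)
↑-B E f n N = begin
  (E n ↑ B f n) N                                              ≡⟨ ↑-diag (E n) n _ N ⟩
  diag n (λ j m → (E n ↑ term (j * j) (c m) (f j)) N)
    ≡⟨ diag-cong n (λ j m → ↑-↑ (E n) (j * j) (c m ∙ f j) N) ⟩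
  diag n (λ j m → term (E n + j * j) (c m) (f j) N)
    ≡⟨ diag-total n (λ n j m → term (E n + j * j) (c m) (f j) N) ⟩
  diag n (λ j m → term (E (j + m) + j * j) (c m) (f j) N)      ∎

-- Apply `c_m = c_{m-1} + q^m c_m` in every summand; the part with `c_{m-1}` is the transform at
-- `n - 1`.
B-c : ∀ f n N → B f n N ≡ prev (B f) n N + diag n (λ j m → term (j * j + m) (c m) (f j) N)
B-c f n N = begin
  B f n N
    ≡⟨ diag-cong n (λ j m → term-c (j * j) m (f j) N) ⟩
  diag n (λ j m → term (j * j) (prev c m) (f j) N + term (j * j + m) (c m) (f j) N)
    ≡⟨ diag-+ n _ _ ⟩
  diag n (λ j m → term (j * j) (prev c m) (f j) N) + diag n (λ j m → term (j * j + m) (c m) (f j) N)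
    ≡⟨ cong (_+ diag n (λ j m → term (j * j + m) (c m) (f j) N)) (diag-prev-B f n N) ⟩
  prev (B f) n N + diag n (λ j m → term (j * j + m) (c m) (f j) N) ∎

-- The factor q^m from `B-c` and the factor q^j in `g` combine to q^n, since `j + m = n`.
B-↑ : ∀ f n → let g = λ j → j ↑ f j in B g n ≗ prev (B g) n ⊕ n ↑ B f n
B-↑ f n N = begin
  B g n N                                                              ≡⟨ B-c g n N ⟩
  prev (B g) n N + diag n (λ j m → term (j * j + m) (c m) (g j) N)
    ≡⟨ cong (prev (B g) n N +_) (diag-cong n (λ j m →
         trans (term-↑ʳ (j * j + m) j (c m) (f j) N) (term-exp (c m) (f j) N (rearr j m)))) ⟩
  prev (B g) n N + diag n (λ j m → term (j + m + j * j) (c m) (f j) N)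
    ≡⟨ cong (prev (B g) n N +_) (↑-B id f n N) ⟨
  prev (B g) n N + (n ↑ B f n) N                                       ∎
  where
  g = λ j → j ↑ f j
  rearr : ∀ j m → j * j + m + j ≡ j + m + j * j
  rearr = solve-∀

-- By `B-c`, `B f n` is its predecessor plus `X`. Weighting the hypothesis by `q^{j²+m} c_m` and
-- summing gives `X + X′ = Y′ + H`. The shift `(j, m) → (j + 1, m - 1)` preserves the exponent in
-- the sense that `(j+1)² + (m-1) = j² + m + 2j`, so `Y′ = Y`; the recurrence of `c` gives
-- `X′ = Y + Z`. Cancelling `Y` leaves `X + Z = H`.
B-bailey : ∀ f h → (∀ j → f j ⊕ (2 * j) ↑ f j ≗ prev f j ⊕ j ↑ h j) →
  ∀ n → B f n ⊕ (2 * n) ↑ B f n ≗ prev (B f) n ⊕ n ↑ B h n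
B-bailey f h p n N = begin
  B f n N + Z            ≡⟨ cong (_+ Z) (B-c f n N) ⟩
  prev (B f) n N + X + Z ≡⟨ +-assoc (prev (B f) n N) X Z ⟩
  prev (B f) n N + (X + Z)
    ≡⟨ cong (prev (B f) n N +_) (+-cancelˡ-≡ Y (X + Z) H main) ⟩
  prev (B f) n N + H     ∎
  where
  X = diag n (λ j m → term (j * j + m) (c m) (f j) N)
  Y = diag n (λ j m → term (j * j + m + 2 * j) (prev c m) (f j) N)
  Z = ((2 * n) ↑ B f n) N
  H = (n ↑ B h n) N
  X′ = diag n (λ j m → term (j * j + m + 2 * j) (c m) (f j) N)
  Y′ = diag n (λ j m → term (j * j + m) (c m) (prev f j) N)

  exp₁ : ∀ j m → j * j + m + j ≡ j + m + j * j
  exp₁ = solve-∀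
  exp₂ : ∀ j m → j * j + m + 2 * j + m ≡ 2 * (j + m) + j * j
  exp₂ = solve-∀
  exp₃ : ∀ j m → (1 + j) * (1 + j) + m ≡ j * j + (1 + m) + 2 * j
  exp₃ = solve-∀

  term-p : ∀ j m → let E = j * j + m in
    term E (c m) (f j) N + term (E + 2 * j) (c m) (f j) N ≡
    term E (c m) (prev f j) N + term (j + m + j * j) (c m) (h j) N
  term-p j m = begin
    term E (c m) (f j) N + term (E + 2 * j) (c m) (f j) N
      ≡⟨ cong (term E (c m) (f j) N +_) (term-↑ʳ E (2 * j) (c m) (f j) N) ⟨
    term E (c m) (f j) N + term E (c m) ((2 * j) ↑ f j) N
      ≡⟨ term-⊕ʳ E (c m) (f j) _ N ⟨
    term E (c m) (f j ⊕ (2 * j) ↑ f j) N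
      ≡⟨ term-congˡ E (c m) (p j) N ⟩
    term E (c m) (prev f j ⊕ j ↑ h j) N
      ≡⟨ term-⊕ʳ E (c m) (prev f j) _ N ⟩
    term E (c m) (prev f j) N + term E (c m) (j ↑ h j) N
      ≡⟨ cong (term E (c m) (prev f j) N +_)
           (trans (term-↑ʳ E j (c m) (h j) N) (term-exp (c m) (h j) N (exp₁ j m))) ⟩
    term E (c m) (prev f j) N + term (j + m + j * j) (c m) (h j) N ∎
    where E = j * j + m

  Y′≡Y : ∀ n → diag n (λ j m → term (j * j + m) (c m) (prev f j) N) ≡
               diag n (λ j m → term (j * j + m + 2 * j) (prev c m) (f j) N)
  Y′≡Y zero    = trans (term-zeroʳ 0 (c 0) N) (sym (term-zeroˡ 0 (f 0) N))
  Y′≡Y (suc n) = begin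
    _ ≡⟨ diag-prev-f (λ j m → j * j + m) f n N ⟩
    diag n (λ j m → term (suc j * suc j + m) (c m) (f j) N)
      ≡⟨ diag-cong n (λ j m → term-exp (c m) (f j) N (exp₃ j m)) ⟩
    diag n (λ j m → term (j * j + suc m + 2 * j) (c m) (f j) N)
      ≡⟨ diag-prev-c (λ j m → j * j + m + 2 * j) f n N ⟨
    _ ∎

  X′≡Y+Z : X′ ≡ Y + Z
  X′≡Y+Z = begin
    X′ ≡⟨ diag-cong n (λ j m → term-c (j * j + m + 2 * j) m (f j) N) ⟩
    diag n (λ j m → term (j * j + m + 2 * j) (prev c m) (f j) N + term (j * j + m + 2 * j + m) (c m) (f j) N)
       ≡⟨ diag-+ n _ _ ⟩
    Y + diag n (λ j m → term (j * j + m + 2 * j + m) (c m) (f j) N)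
       ≡⟨ cong (Y +_) (diag-cong n (λ j m → term-exp (c m) (f j) N (exp₂ j m))) ⟩
    Y + diag n (λ j m → term (2 * (j + m) + j * j) (c m) (f j) N)
       ≡⟨ cong (Y +_) (↑-B (2 *_) f n N) ⟨
    Y + Z ∎

  main : Y + (X + Z) ≡ Y + H
  main = begin
    Y + (X + Z)   ≡⟨ rearr Y X Z ⟩
    X + (Y + Z)   ≡⟨ cong (X +_) X′≡Y+Z ⟨
    X + X′        ≡⟨ diag-+ n _ _ ⟨
    diag n (λ j m → term (j * j + m) (c m) (f j) N + term (j * j + m + 2 * j) (c m) (f j) N)
      ≡⟨ diag-cong n term-p ⟩
    diag n (λ j m → term (j * j + m) (c m) (prev f j) N + term (j + m + j * j) (c m) (h j) N)
      ≡⟨ diag-+ n _ _ ⟩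
    Y′ + diag n (λ j m → term (j + m + j * j) (c m) (h j) N)
      ≡⟨ cong₂ _+_ (Y′≡Y n) (sym (↑-B id h n N)) ⟩
    Y + H ∎
    where
    rearr : ∀ y x z → y + (x + z) ≡ x + (y + z)
    rearr = solve-∀

-- `u 1` is the sequence u of the overview. The parameter `t` interpolates: it is needed for the
-- functional equation of `Λ`.
u : ℕ → ℕ → PS
u t = B (λ k → (t * k) ↑ e k)

u-suc : ∀ t n → u (suc t) n ≗ prev (u (suc t)) n ⊕ n ↑ u t n
u-suc t n N = begin
  u (suc t) n N                 ≡⟨ eq n N ⟩
  B g n N                       ≡⟨ B-↑ f n N ⟩
  prev (B g) n N + (n ↑ u t n) N
    ≡⟨ cong (_+ (n ↑ u t n) N) (prev-eq n) ⟩
  prev (u (suc t)) n N + (n ↑ u t n) N ∎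
  where
  f = λ k → (t * k) ↑ e k
  g = λ k → k ↑ f k
  eq : ∀ n → u (suc t) n ≗ B g n
  eq = B-cong (λ k M → sym (↑-↑ k (t * k) (e k) M))
  prev-eq : ∀ n → prev (B g) n N ≡ prev (u (suc t)) n N
  prev-eq zero    = refl
  prev-eq (suc n) = sym (eq n N)

-- Expand with `B-c` and then apply `e_k = e_{k-1} + q^{2k} e_k` to the remainder. In the part with
-- `e_k` the exponent becomes `n + k² + (t+1)k`; in the part with `e_{k-1}`, shifting `k` produces
-- `t + n + k² + (t+1)k` with the total lowered by one.
u-step : ∀ t n N → u t n N ≡
  (prev (u t) n N + (n ↑ u (suc t) n) N) + ((t + n) ↑ prev (u (suc t)) n) N
u-step t n N = begin
  u t n N ≡⟨ B-c f n N ⟩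
  prev (u t) n N + diag n (λ k m → term (k * k + m) (c m) (f k) N)
    ≡⟨ cong (prev (u t) n N +_) (trans (diag-cong n split) (diag-+ n _ _)) ⟩
  prev (u t) n N + (diag n (λ k m → term (k + m + k * k) (c m) (f′ k) N)
                    + diag n (λ k m → term (k * k + m + t * k) (c m) (prev e k) N))
    ≡⟨ cong (prev (u t) n N +_) (cong₂ _+_ (sym (↑-B id f′ n N)) (shifted n)) ⟩
  prev (u t) n N + ((n ↑ u (suc t) n) N + ((t + n) ↑ prev (u (suc t)) n) N)
    ≡⟨ +-assoc (prev (u t) n N) _ _ ⟨
  (prev (u t) n N + (n ↑ u (suc t) n) N) + ((t + n) ↑ prev (u (suc t)) n) N ∎
  where
  f  = λ k → (t * k) ↑ e k
  f′ = λ k → (suc t * k) ↑ e k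

  exp₁ : ∀ t k m → k * k + m + t * k + 2 * k ≡ k + m + k * k + (1 + t) * k
  exp₁ = solve-∀
  exp₂ : ∀ t k m → (1 + k) * (1 + k) + m + t * (1 + k) ≡ t + (1 + (k + m)) + k * k + (1 + t) * k
  exp₂ = solve-∀

  split : ∀ k m → term (k * k + m) (c m) (f k) N ≡
    term (k + m + k * k) (c m) (f′ k) N + term (k * k + m + t * k) (c m) (prev e k) N
  split k m = begin
    term (k * k + m) (c m) (f k) N                       ≡⟨ term-↑ʳ (k * k + m) (t * k) (c m) (e k) N ⟩
    term E (c m) (e k) N                                 ≡⟨ term-congˡ E (c m) (e-rec k) N ⟩
    term E (c m) (prev e k ⊕ (2 * k) ↑ e k) N            ≡⟨ term-⊕ʳ E (c m) (prev e k) _ N ⟩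
    term E (c m) (prev e k) N + term E (c m) ((2 * k) ↑ e k) N
      ≡⟨ +-comm (term E (c m) (prev e k) N) _ ⟩
    term E (c m) ((2 * k) ↑ e k) N + term E (c m) (prev e k) N
      ≡⟨ cong (_+ term E (c m) (prev e k) N) (begin
           term E (c m) ((2 * k) ↑ e k) N                        ≡⟨ term-↑ʳ E (2 * k) (c m) (e k) N ⟩
           term (E + 2 * k) (c m) (e k) N                        ≡⟨ term-exp (c m) (e k) N (exp₁ t k m) ⟩
           term (k + m + k * k + (suc t) * k) (c m) (e k) N      ≡⟨ term-↑ʳ (k + m + k * k) (suc t * k) (c m) (e k) N ⟨
           term (k + m + k * k) (c m) (f′ k) N                   ∎) ⟩
    term (k + m + k * k) (c m) (f′ k) N + term E (c m) (prev e k) N ∎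
    where E = k * k + m + t * k

  shifted : ∀ n → diag n (λ k m → term (k * k + m + t * k) (c m) (prev e k) N) ≡
                  ((t + n) ↑ prev (u (suc t)) n) N
  shifted zero    = trans (term-zeroʳ (t * 0) (c 0) N) (sym (↑-zero (t + 0) N))
  shifted (suc n) = begin
    _ ≡⟨ diag-prev-f (λ k m → k * k + m + t * k) e n N ⟩
    diag n (λ k m → term (suc k * suc k + m + t * suc k) (c m) (e k) N)
      ≡⟨ diag-cong n (λ k m → trans (term-exp (c m) (e k) N (exp₂ t k m))
           (sym (term-↑ʳ (t + suc (k + m) + k * k) (suc t * k) (c m) (e k) N))) ⟩
    diag n (λ k m → term (t + suc (k + m) + k * k) (c m) (f′ k) N)
      ≡⟨ ↑-B (λ n → t + suc n) f′ n N ⟨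
    ((t + suc n) ↑ u (suc t) n) N ∎

-- U n, V n, W n will be the series of profiles (2,0,0,0), (1,1,0,0), (1,0,1,0) with entries ≤ n.
U V W : ℕ → PS
U = B (λ j → j ↑ u 1 j)
V = B (u 1)
W = B (u 0)

U-rec : ∀ n → U n ≗ prev U n ⊕ n ↑ V n
U-rec = B-↑ (u 1)

-- `B-bailey` for `f = e`: adding `q^{2k} e_k` to both sides of `e-rec` gives the hypothesis with
-- `h_k = 2 q^k e_k`, whose transform is twice `u 1`.
u0-rec : ∀ n → u 0 n ⊕ (2 * n) ↑ u 0 n ≗ prev (u 0) n ⊕ n ↑ (u 1 n ⊕ u 1 n)
u0-rec n N = begin
  _ ≡⟨ B-bailey e h hyp n N ⟩
  prev (u 0) n N + (n ↑ B h n) N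
    ≡⟨ cong (prev (u 0) n N +_) (↑-cong n (λ M → trans (B-⊕ g g n M)
         (cong₂ _+_ (eq n M) (eq n M))) N) ⟩
  _ ∎
  where
  g = λ k → k ↑ e k
  h = λ k → g k ⊕ g k
  eq : ∀ n → B g n ≗ u 1 n
  eq = B-cong (λ k M → ↑-exp (e k) M (sym (*-identityˡ k)))
  exp : ∀ k → k + k ≡ 2 * k
  exp = solve-∀
  hyp : ∀ k → e k ⊕ (2 * k) ↑ e k ≗ prev e k ⊕ k ↑ h k
  hyp k M = begin
    e k M + E                ≡⟨ cong (_+ E) (e-rec k M) ⟩
    prev e k M + E + E       ≡⟨ +-assoc (prev e k M) E E ⟩
    prev e k M + (E + E)     ≡⟨ cong (prev e k M +_) (cong₂ _+_ up up) ⟩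
    prev e k M + ((k ↑ g k) M + (k ↑ g k) M)  ≡⟨ cong (prev e k M +_) (↑-⊕ k (g k) (g k) M) ⟨
    prev e k M + (k ↑ h k) M ∎
    where
    E = ((2 * k) ↑ e k) M
    up : E ≡ (k ↑ g k) M
    up = sym (trans (↑-↑ k k (e k) M) (↑-exp (e k) M (exp k)))

-- This is `u-suc 0` with `q^{2n} u 1 n` added to both sides, which is the shape that a further use
-- of `B-bailey` requires.
u1-rec : ∀ n → u 1 n ⊕ (2 * n) ↑ u 1 n ≗ prev (u 1) n ⊕ n ↑ (u 0 n ⊕ n ↑ u 1 n)
u1-rec n N = begin
  u 1 n N + ((2 * n) ↑ u 1 n) N
    ≡⟨ cong₂ _+_ (u-suc 0 n N) (sym (trans (↑-↑ n n (u 1 n) N) (↑-exp (u 1 n) N (exp n)))) ⟩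
  prev (u 1) n N + (n ↑ u 0 n) N + (n ↑ n ↑ u 1 n) N
    ≡⟨ +-assoc (prev (u 1) n N) _ _ ⟩
  prev (u 1) n N + ((n ↑ u 0 n) N + (n ↑ n ↑ u 1 n) N)
    ≡⟨ cong (prev (u 1) n N +_) (↑-⊕ n (u 0 n) _ N) ⟨
  prev (u 1) n N + (n ↑ (u 0 n ⊕ n ↑ u 1 n)) N ∎
  where
  exp : ∀ k → k + k ≡ 2 * k
  exp = solve-∀

W-rec : ∀ n → W n ⊕ (2 * n) ↑ W n ≗ prev W n ⊕ n ↑ (V n ⊕ V n)
W-rec n N = trans (B-bailey (u 0) _ u0-rec n N)
  (cong (prev W n N +_) (↑-cong n (B-⊕ (u 1) (u 1) n) N))

-- Second application of the transform: in `h_j = u 0 j + q^j u 1 j` the first summand becomes `W`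
-- and the second becomes `U`.
V-rec : ∀ n → V n ⊕ (2 * n) ↑ V n ≗ prev V n ⊕ n ↑ (W n ⊕ U n)
V-rec n N = trans (B-bailey (u 1) _ u1-rec n N)
  (cong (prev V n N +_) (↑-cong n (B-⊕ (u 0) _ n) N))

-- Passing to the limit

-- For `t = 0` this is, up to the factor `1/(q;q)_∞`, the limit of `B g n` as n grows (`B-limit`).
θ : ℕ → (ℕ → PS) → PS
θ t g = ∑ (λ n → (n * n + t * n) ↑ g n)

n≤n*n+k : ∀ n k → n ≤ n * n + k
n≤n*n+k zero    k = z≤n
n≤n*n+k (suc n) k = ≤-trans (m≤m*n (suc n) (suc n)) (m≤m+n _ k)

θ-vanishing : ∀ t g → Vanishing (λ n → (n * n + t * n) ↑ g n)
θ-vanishing t g = ↑-vanishing (λ n → n * n + t * n) g (λ n → n≤n*n+k n (t * n))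

θ-cong : ∀ t {g h} → (∀ n → g n ≗ h n) → θ t g ≗ θ t h
θ-cong t p = ∑-cong (λ n → ↑-cong (n * n + t * n) (p n))

θ-⊕ : ∀ t g h → θ t (λ n → g n ⊕ h n) ≗ θ t g ⊕ θ t h
θ-⊕ t g h N = trans (∑-cong (λ n → ↑-⊕ (n * n + t * n) (g n) (h n)) N)
  (∑-⊕ (λ n → (n * n + t * n) ↑ g n) (λ n → (n * n + t * n) ↑ h n) N)

θ-↑ : ∀ t k g → θ t (λ n → k ↑ g n) ≗ k ↑ θ t g
θ-↑ t k g N = trans
  (∑-cong (λ n M → begin
    (E n ↑ k ↑ g n) M       ≡⟨ ↑-↑ (E n) k (g n) M ⟩
    ((E n + k) ↑ g n) M     ≡⟨ ↑-exp (g n) M (+-comm (E n) k) ⟩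
    ((k + E n) ↑ g n) M     ≡⟨ ↑-↑ k (E n) (g n) M ⟨
    (k ↑ E n ↑ g n) M       ∎) N)
  (∑-↑ k (θ-vanishing t g) N)
  where
  E : ℕ → ℕ
  E n = n * n + t * n

θ-scale : ∀ t k g → θ t (λ n → (k * n) ↑ g n) ≗ θ (k + t) g
θ-scale t k g = ∑-cong (λ n M →
  trans (↑-↑ (n * n + t * n) (k * n) (g n) M) (↑-exp (g n) M (exp t k n)))
  where
  exp : ∀ t k n → n * n + t * n + k * n ≡ n * n + (k + t) * n
  exp = solve-∀

θ-suc : ∀ t g → θ t (λ n → n ↑ g n) ≗ θ (suc t) g
θ-suc t g N = trans (θ-cong t (λ n M → ↑-exp (g n) M (sym (*-identityˡ n))) N) (θ-scale t 1 g N)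

-- Shift n and complete the square: `(n+1)² + t(n+1) = (t+1) + n² + (t+2)n`.
θ-prev : ∀ t g → θ t (prev g) ≗ suc t ↑ θ (2 + t) g
θ-prev t g N = begin
  θ t (prev g) N
    ≡⟨ ∑-prev (λ n → n * n + t * n) g (λ n → n≤n*n+k n (t * n)) N ⟩
  ∑ (λ n → (suc n * suc n + t * suc n) ↑ g n) N
    ≡⟨ ∑-cong (λ n M → trans (↑-exp (g n) M (exp t n))
         (sym (↑-↑ (suc t) (n * n + (2 + t) * n) (g n) M))) N ⟩
  ∑ (λ n → suc t ↑ (n * n + (2 + t) * n) ↑ g n) N
    ≡⟨ ∑-↑ (suc t) (θ-vanishing (2 + t) g) N ⟩
  (suc t ↑ θ (2 + t) g) N ∎
  where
  exp : ∀ t n → (1 + n) * (1 + n) + t * (1 + n) ≡ 1 + t + (n * n + (2 + t) * n)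
  exp = solve-∀

-- Every summand with `n ≥ 1` starts at a power of q above `t ≥ N`, so only `n = 0` contributes.
θ-limit : ∀ t g N → N ≤ t → θ t g N ≡ g 0 N
θ-limit t g zero    p = ↑-exp (g 0) 0 (*-zeroʳ t)
θ-limit t g (suc N) p = begin
  ((t * 0) ↑ g 0) (suc N) + diag N (λ n _ → ((suc n * suc n + t * suc n) ↑ g (suc n)) (suc N))
    ≡⟨ cong₂ _+_ (↑-exp (g 0) (suc N) (*-zeroʳ t))
                 (trans (diag-cong N (λ n _ → ↑-below (suc n * suc n + t * suc n) (g (suc n)) (suc N)
                           (≤-<-trans p (s≤s (≤-trans (m≤m*n t (suc n)) (m≤n+m (t * suc n) _))))))
                        (diag-0 N)) ⟩
  g 0 (suc N) + 0 ≡⟨ +-identityʳ _ ⟩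
  g 0 (suc N)     ∎

-- Functional equations in the parameter t

Functional : (ℕ → PS) → Set
Functional X = ∀ t → X t ≗ X (suc t) ⊕ suc t ↑ X (suc t)

UnitLimit : (ℕ → PS) → Set
UnitLimit X = ∀ t N → N ≤ t → X t N ≡ oneS N

-- Each use of the equation raises `t` by one and involves only coefficients up to N; once `t ≥ N`
-- the limit condition fixes them. The induction is on `d`, a bound for the number of uses left.
functional-unique : ∀ {X Y} → Functional X → Functional Y → UnitLimit X → UnitLimit Y →
  ∀ t → X t ≗ Y t
functional-unique {X} {Y} fX fY lX lY t N = go N t N (m≤m+n N t)
  where
  go : ∀ d t N → N ≤ d + t → X t N ≡ Y t N
  go zero    t N p = trans (lX t N p) (sym (lY t N p))
  go (suc d) t N p = begin
    X t N                                     ≡⟨ fX t N ⟩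
    X (suc t) N + (suc t ↑ X (suc t)) N
      ≡⟨ cong₂ _+_ (go d (suc t) N q) (↑-cong-on (suc t) N (λ M r →
           go d (suc t) M (≤-trans (subst (M ≤_) r (m≤n+m M (suc t))) q))) ⟩
    Y (suc t) N + (suc t ↑ Y (suc t)) N       ≡⟨ fY t N ⟨
    Y t N                                     ∎
    where
    q : N ≤ d + suc t
    q = subst (N ≤_) (sym (+-suc d t)) p

A : ℕ → PS
A t = θ t e

-- Both halves of `e-rec` raise the parameter by two: the shift of n through `θ-prev`, the factor
-- q^{2n} through `θ-scale`.
A-rec : ∀ t → A t ≗ A (2 + t) ⊕ suc t ↑ A (2 + t)
A-rec t N = begin
  θ t e N                                           ≡⟨ θ-cong t e-rec N ⟩
  θ t (λ n → prev e n ⊕ (2 * n) ↑ e n) N            ≡⟨ θ-⊕ t (prev e) _ N ⟩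
  θ t (prev e) N + θ t (λ n → (2 * n) ↑ e n) N      ≡⟨ cong₂ _+_ (θ-prev t e N) (θ-scale t 2 e N) ⟩
  (suc t ↑ A (2 + t)) N + A (2 + t) N               ≡⟨ +-comm _ (A (2 + t) N) ⟩
  A (2 + t) N + (suc t ↑ A (2 + t)) N               ∎

AA Λ : ℕ → PS
AA t = A t ∙ A (suc t)
Λ t  = θ t (u (suc t))

-- `A-rec` turns `A t` into `(1 + q^{t+1}) A (2 + t)`, and the other factor `A (suc t)` is shared
-- with `AA (suc t)`.
AA-functional : Functional AA
AA-functional t N = begin
  (A t ∙ A′) N                             ≡⟨ ∙-congʳ A′ (A-rec t) N ⟩
  ((A″ ⊕ suc t ↑ A″) ∙ A′) N               ≡⟨ ∙-⊕ˡ A″ _ A′ N ⟩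
  (A″ ∙ A′) N + ((suc t ↑ A″) ∙ A′) N
    ≡⟨ cong₂ _+_ (∙-comm A″ A′ N) (trans (↑-∙ˡ (suc t) A″ A′ N) (↑-cong (suc t) (∙-comm A″ A′) N)) ⟩
  (A′ ∙ A″) N + (suc t ↑ (A′ ∙ A″)) N      ∎
  where A′ = A (suc t)
        A″ = A (2 + t)

AA-limit : UnitLimit AA
AA-limit t N p = trans
  (diag-cong-on N (λ i j q → cong₂ _*_
    (θ-limit t e i (≤-trans (subst (i ≤_) q (m≤m+n i j)) p))
    (θ-limit (suc t) e j (≤-trans (subst (j ≤_) q (m≤n+m j i)) (m≤n⇒m≤1+n p)))))
  (∙-identityˡ oneS N)

Λ-limit : UnitLimit Λ
Λ-limit t N p = begin
  Λ t N                          ≡⟨ θ-limit t (u (suc t)) N p ⟩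
  (oneS ∙ ((t * 0) ↑ oneS)) N    ≡⟨ ∙-identityˡ _ N ⟩
  ((t * 0) ↑ oneS) N             ≡⟨ ↑-exp oneS N (*-zeroʳ t) ⟩
  oneS N                         ∎

-- `u-step` splits `Λ t` into `Λ τ` and two terms with the factor q^τ. By `u-suc` those two are the
-- two halves of `Λ τ` (`merge`).
Λ-functional : Functional Λ
Λ-functional t N = begin
  θ t (u τ) N
    ≡⟨ θ-cong t (u-step τ) N ⟩
  θ t (λ n → (prev (u τ) n ⊕ n ↑ u τ⁺ n) ⊕ (τ + n) ↑ prev (u τ⁺) n) N
    ≡⟨ trans (θ-⊕ t _ _ N) (cong (_+ θ t (λ n → (τ + n) ↑ prev (u τ⁺) n) N) (θ-⊕ t (prev (u τ)) _ N)) ⟩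
  θ t (prev (u τ)) N + θ t (λ n → n ↑ u τ⁺ n) N + θ t (λ n → (τ + n) ↑ prev (u τ⁺) n) N
    ≡⟨ cong₂ _+_ (cong₂ _+_ (θ-prev t (u τ) N) (θ-suc t (u τ⁺) N)) pull ⟩
  (τ ↑ θ τ⁺ (u τ)) N + Λ τ N + (τ ↑ θ τ (prev (u τ⁺))) N
    ≡⟨ rearr ((τ ↑ θ τ⁺ (u τ)) N) (Λ τ N) ((τ ↑ θ τ (prev (u τ⁺))) N) ⟩
  Λ τ N + ((τ ↑ θ τ (prev (u τ⁺))) N + (τ ↑ θ τ⁺ (u τ)) N)
    ≡⟨ cong (Λ τ N +_) (↑-⊕ τ _ _ N) ⟨
  Λ τ N + (τ ↑ (θ τ (prev (u τ⁺)) ⊕ θ τ⁺ (u τ))) N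
    ≡⟨ cong (Λ τ N +_) (↑-cong τ merge N) ⟨
  Λ τ N + (τ ↑ Λ τ) N ∎
  where
  τ  = suc t
  τ⁺ = suc τ
  rearr : ∀ x y z → x + y + z ≡ y + (z + x)
  rearr = solve-∀
  pull : θ t (λ n → (τ + n) ↑ prev (u τ⁺) n) N ≡ (τ ↑ θ τ (prev (u τ⁺))) N
  pull = begin
    _ ≡⟨ θ-cong t (λ n M → sym (↑-↑ τ n (prev (u τ⁺) n) M)) N ⟩
    θ t (λ n → τ ↑ n ↑ prev (u τ⁺) n) N        ≡⟨ θ-↑ t τ (λ n → n ↑ prev (u τ⁺) n) N ⟩
    (τ ↑ θ t (λ n → n ↑ prev (u τ⁺) n)) N      ≡⟨ ↑-cong τ (θ-suc t (prev (u τ⁺))) N ⟩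
    (τ ↑ θ τ (prev (u τ⁺))) N                  ∎
  merge : Λ τ ≗ θ τ (prev (u τ⁺)) ⊕ θ τ⁺ (u τ)
  merge M = begin
    θ τ (u τ⁺) M                                     ≡⟨ θ-cong τ (u-suc τ) M ⟩
    θ τ (λ n → prev (u τ⁺) n ⊕ n ↑ u τ n) M          ≡⟨ θ-⊕ τ (prev (u τ⁺)) _ M ⟩
    θ τ (prev (u τ⁺)) M + θ τ (λ n → n ↑ u τ n) M    ≡⟨ cong (θ τ (prev (u τ⁺)) M +_) (θ-suc τ (u τ) M) ⟩
    θ τ (prev (u τ⁺)) M + θ τ⁺ (u τ) M               ∎

-- The right-hand side in terms of Euler sums

rrSum≗A : rrSum ≗ A 0
rrSum≗A N = trans (sum-upTo N _) (diag-cong N (λ n _ → begin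
  (mono (n * n) ⊛ e n) N          ≡⟨ ⊛≗∙ (mono (n * n)) (e n) N ⟩
  (mono (n * n) ∙ e n) N          ≡⟨ ∙-congʳ (e n) (mono≗↑ (n * n)) N ⟩
  (((n * n) ↑ oneS) ∙ e n) N      ≡⟨ ↑-∙ˡ (n * n) oneS (e n) N ⟩
  ((n * n) ↑ (oneS ∙ e n)) N      ≡⟨ ↑-cong (n * n) (∙-identityˡ (e n)) N ⟩
  ((n * n) ↑ e n) N               ≡⟨ ↑-exp (e n) N (+-identityʳ (n * n)) ⟨
  ((n * n + 0 * n) ↑ e n) N       ∎))

onePlus-∙ : ∀ k f → onePlus k ∙ f ≗ f ⊕ k ↑ f
onePlus-∙ k f N = begin
  (onePlus k ∙ f) N                ≡⟨ ∙-⊕ˡ oneS (mono k) f N ⟩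
  (oneS ∙ f) N + (mono k ∙ f) N
    ≡⟨ cong₂ _+_ (∙-identityˡ f N) (begin
         (mono k ∙ f) N            ≡⟨ ∙-congʳ f (mono≗↑ k) N ⟩
         ((k ↑ oneS) ∙ f) N        ≡⟨ ↑-∙ˡ k oneS f N ⟩
         (k ↑ (oneS ∙ f)) N        ≡⟨ ↑-cong k (∙-identityˡ f) N ⟩
         (k ↑ f) N                 ∎) ⟩
  f N + (k ↑ f) N                  ∎

-- Euler's product: iterating `A-rec` from `t = 1` in steps of two extracts the factors
-- `1 + q^{2k}`. After N steps the remaining `A (1 + 2 * N)` agrees with 1 up to q^N.
negPochInf≗A : negPochInf ≗ A 1
negPochInf≗A N = begin
  p N N                              ≡⟨ ∙-identityʳ (p N) N ⟨
  (p N ∙ oneS) N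
    ≡⟨ diag-cong-on N (λ i j q → cong (p N i *_) (sym (θ-limit (1 + 2 * N) e j
         (≤-trans (subst (j ≤_) q (m≤n+m j i)) (m≤n⇒m≤1+n (m≤n*m N 2)))))) ⟩
  (p N ∙ A (1 + 2 * N)) N            ≡⟨ unroll N N ⟨
  A 1 N                              ∎
  where
  p : ℕ → PS
  p n = prodTo n (λ k → onePlus (2 * k))
  unroll : ∀ n → A 1 ≗ p n ∙ A (1 + 2 * n)
  unroll zero    M = sym (∙-identityˡ (A 1) M)
  unroll (suc n) M = begin
    A 1 M                                              ≡⟨ unroll n M ⟩
    (p n ∙ A (1 + 2 * n)) M                            ≡⟨ ∙-congˡ (p n) step M ⟩
    (p n ∙ (onePlus (2 * suc n) ∙ A (1 + 2 * suc n))) M ≡⟨ ∙-assoc (p n) _ (A (1 + 2 * suc n)) M ⟨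
    ((p n ∙ onePlus (2 * suc n)) ∙ A (1 + 2 * suc n)) M
      ≡⟨ ∙-congʳ (A (1 + 2 * suc n)) (⊛≗∙ (p n) (onePlus (2 * suc n))) M ⟨
    (p (suc n) ∙ A (1 + 2 * suc n)) M                  ∎
    where
    exp : ∀ n → 2 + 2 * n ≡ 2 * (1 + n)
    exp = solve-∀
    step : A (1 + 2 * n) ≗ onePlus (2 * suc n) ∙ A (1 + 2 * suc n)
    step M = begin
      A (1 + 2 * n) M                                           ≡⟨ A-rec (1 + 2 * n) M ⟩
      A (3 + 2 * n) M + ((2 + 2 * n) ↑ A (3 + 2 * n)) M
        ≡⟨ cong (λ k → A (1 + k) M + (k ↑ A (1 + k)) M) (exp n) ⟩
      A (1 + 2 * suc n) M + ((2 * suc n) ↑ A (1 + 2 * suc n)) M ≡⟨ onePlus-∙ (2 * suc n) (A (1 + 2 * suc n)) M ⟨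
      (onePlus (2 * suc n) ∙ A (1 + 2 * suc n)) M               ∎

c-stable : ∀ m i → i ≤ m → c m i ≡ invPochInf i
c-stable m i p = trans (cong (λ k → c k i) (sym (m∸n+n≡m p))) (go (m ∸ i))
  where
  go : ∀ d → c (d + i) i ≡ c i i
  go zero    = refl
  go (suc d) = begin
    c (suc (d + i)) i                                       ≡⟨ c-rec (suc (d + i)) i ⟩
    c (d + i) i + (suc (d + i) ↑ c (suc (d + i))) i
      ≡⟨ cong₂ _+_ (go d) (↑-below (suc (d + i)) _ i (s≤s (m≤n+m i d))) ⟩
    c i i + 0                                               ≡⟨ +-identityʳ _ ⟩
    c i i                                                   ∎

-- The coefficient of q^N has already reached its limit at index N. In the summand of `j` and `m`
-- only coefficients of `c m` up to `N - j²` occur, and `N - j² ≤ N - j = m`, so `c-stable` applies.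
B-limit : ∀ f N → B f N N ≡ (invPochInf ∙ θ 0 f) N
B-limit f N = begin
  diag N (λ j m → term (j * j) (c m) (f j) N)
    ≡⟨ diag-cong-on N (λ j m q → ↑-cong-on (j * j) N (λ M r → diag-cong-on M (λ a b s →
         cong (_* f j b) (c-stable m a (bound j m M a b q r s))))) ⟩
  diag N (λ j m → term (j * j) invPochInf (f j) N)
    ≡⟨ diag-cong N (λ j m → trans (↑-exp (invPochInf ∙ f j) N (sym (+-identityʳ (j * j))))
                                  (sym (↑-∙ʳ (j * j + 0 * j) invPochInf (f j) N))) ⟩
  ∑ (λ j → invPochInf ∙ ((j * j + 0 * j) ↑ f j)) N
    ≡⟨ ∑-∙ invPochInf (θ-vanishing 0 f) N ⟩
  (invPochInf ∙ θ 0 f) N ∎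
  where
  bound : ∀ j m M a b → j + m ≡ N → j * j + M ≡ N → a + b ≡ M → a ≤ m
  bound j m M a b q r s = ≤-trans (subst (a ≤_) s (m≤m+n a b))
    (+-cancelˡ-≤ j M m (subst (j + M ≤_) (trans r (sym q))
      (+-monoˡ-≤ M (subst (j ≤_) (+-identityʳ (j * j)) (n≤n*n+k j 0)))))

V-limit : ∀ N → V N N ≡ rhs56 N
V-limit N = begin
  V N N                                              ≡⟨ B-limit (u 1) N ⟩
  (invPochInf ∙ Λ 0) N
    ≡⟨ ∙-congˡ invPochInf (functional-unique Λ-functional AA-functional Λ-limit AA-limit 0) N ⟩
  (invPochInf ∙ (A 0 ∙ A 1)) N                       ≡⟨ ∙-comm invPochInf (A 0 ∙ A 1) N ⟩
  ((A 0 ∙ A 1) ∙ invPochInf) N                       ≡⟨ ∙-assoc (A 0) (A 1) invPochInf N ⟩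
  (A 0 ∙ (A 1 ∙ invPochInf)) N
    ≡⟨ ∙-cong rrSum≗A (λ M → trans (⊛≗∙ negPochInf invPochInf M) (∙-congʳ invPochInf negPochInf≗A M)) N ⟨
  (rrSum ∙ (negPochInf ⊛ invPochInf)) N              ≡⟨ ⊛≗∙ rrSum (negPochInf ⊛ invPochInf) N ⟨
  rhs56 N                                            ∎

-- Enumeration of cylindric partitions

record Counted {A : Set} (P : A → Set) (k : ℕ) : Set where
  field
    elements : List A
    unique   : Unique elements
    sound    : ∀ {x} → x ∈ elements → P x
    complete : ∀ {x} → P x → x ∈ elements
    card     : length elements ≡ k

module _ {A : Set} where
  open Counted

  counted-≡ : ∀ {P : A → Set} {k l} → k ≡ l → Counted P k → Counted P l
  counted-≡ refl C = C

  counted-⇔ : ∀ {P Q : A → Set} {k} → (∀ {x} → P x → Q x) → (∀ {x} → Q x → P x) →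
    Counted P k → Counted Q k
  counted-⇔ f g C = record
    { elements = elements C ; unique = unique C ; card = card C
    ; sound = f ∘ sound C ; complete = complete C ∘ g }

  counted-∅ : ∀ {P : A → Set} → (∀ {x} → ¬ P x) → Counted P 0
  counted-∅ ¬P = record
    { elements = [] ; unique = [] ; card = refl
    ; sound = λ () ; complete = λ p → contradiction p ¬P }

  counted-singleton : ∀ {P : A → Set} x → P x → (∀ {y} → P y → y ≡ x) → Counted P 1
  counted-singleton x p q = record
    { elements = x ∷ [] ; unique = [] ∷ [] ; card = refl
    ; sound = λ { (here refl) → p } ; complete = λ r → here (q r) }

  counted-map : ∀ {B : Set} {P : A → Set} {Q : B → Set} {k} (f : A → B) →
    (∀ {x y} → f x ≡ f y → x ≡ y) → (∀ {x} → P x → Q (f x)) →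
    (∀ {y} → Q y → ∃ λ x → P x × y ≡ f x) → Counted P k → Counted Q k
  counted-map {P = P} {Q} f inj to from C = record
    { elements = map f (elements C)
    ; unique   = Unique.map⁺ inj (unique C)
    ; card     = trans (length-map f (elements C)) (card C)
    ; sound    = snd
    ; complete = cmp }
    where
    snd : ∀ {y} → y ∈ map f (elements C) → Q y
    snd m with ∈-map⁻ f m
    ... | x , x∈ , refl = to (sound C x∈)
    cmp : ∀ {y} → Q y → y ∈ map f (elements C)
    cmp q with from q
    ... | x , p , refl = ∈-map⁺ f (complete C p)

  counted-⊎ : ∀ {P Q : A → Set} {k l} → (∀ {x} → P x → ¬ Q x) →
    Counted P k → Counted Q l → Counted (λ x → P x ⊎ Q x) (k + l)
  counted-⊎ {P} {Q} dis C D = record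
    { elements = elements C ++ elements D
    ; unique   = Unique.++⁺ (unique C) (unique D) (λ (x∈ , y∈) → dis (sound C x∈) (sound D y∈))
    ; card     = trans (length-++ (elements C)) (cong₂ _+_ (card C) (card D))
    ; sound    = λ x∈ → [ inj₁ ∘ sound C , inj₂ ∘ sound D ]′ (∈-++⁻ (elements C) x∈)
    ; complete = [ ∈-++⁺ˡ ∘ complete C , ∈-++⁺ʳ (elements C) ∘ complete D ]′ }

-- Cylindric partitions with bounded entries

Quad : Set
Quad = Vec (List ℕ) 4

Bounded : ℕ → List ℕ → Set
Bounded n xs = IsPartition xs × part xs 0 ≤ n

Above : ℕ → List ℕ → List ℕ → Set
Above k xs ys = ∀ j → part ys (j + k) ≤ part xs j

-- Separate bounds for the four components allow a bound to be raised in one component at a time.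
-- The entry `p₀` governs the wrap-around from the last component to the first.
data Cyl : Vec ℕ 4 → Vec ℕ 4 → ℕ → Quad → Set where
  cyl : ∀ {p₀ p₁ p₂ p₃ n₀ n₁ n₂ n₃ N a b c d} →
    Bounded n₀ a → Bounded n₁ b → Bounded n₂ c → Bounded n₃ d →
    Above p₁ a b → Above p₂ b c → Above p₃ c d → Above p₀ d a →
    size (a ∷ b ∷ c ∷ d ∷ []) ≡ N →
    Cyl (p₀ ∷ p₁ ∷ p₂ ∷ p₃ ∷ []) (n₀ ∷ n₁ ∷ n₂ ∷ n₃ ∷ []) N (a ∷ b ∷ c ∷ d ∷ [])

part≤head : ∀ {xs} → Linked _≥_ xs → ∀ k → part xs k ≤ part xs 0
part≤head {xs}          l       zero    = ≤-refl
part≤head {[]}          l       (suc k) = z≤n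
part≤head {x ∷ []}      l       (suc k) = z≤n
part≤head {x ∷ y ∷ xs}  (p ∷ l) (suc k) = ≤-trans (part≤head l k) p

loosen : ∀ {m n xs} → m ≤ n → Bounded m xs → Bounded n xs
loosen m≤n (p , h) = p , ≤-trans h m≤n

-- At a zero profile entry the largest parts themselves are compared, so a bound passes on to the
-- next component.
tighten : ∀ {m n xs ys} → Bounded m xs → Above 0 xs ys → Bounded n ys → Bounded m ys
tighten (_ , h) s (p , _) = p , ≤-trans (s 0) h

Bounded-∷⁺ : ∀ {n a} → Bounded (suc n) a → Bounded (suc n) (suc n ∷ a)
Bounded-∷⁺ {a = []}    _             = ([-] , z<s ∷ []) , ≤-refl
Bounded-∷⁺ {a = _ ∷ _} ((l , q) , h) = (h ∷ l , z<s ∷ q) , ≤-refl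

Bounded-∷⁻ : ∀ {m n a} → Bounded m (n ∷ a) → Bounded n a
Bounded-∷⁻ {a = []}    _                       = ([] , []) , z≤n
Bounded-∷⁻ {a = _ ∷ _} ((h ∷ l , _ ∷ q) , _) = (l , q) , h

Bounded-0 : ∀ {a} → Bounded 0 a → a ≡ []
Bounded-0 {[]}    _                   = refl
Bounded-0 {x ∷ a} ((_ , 0<x ∷ _) , h) = contradiction h (<⇒≱ 0<x)

Above-∷ˡ⁺ : ∀ {k n} a b → part b k ≤ n → Above (suc k) a b → Above k (n ∷ a) b
Above-∷ˡ⁺     a b h s zero    = h
Above-∷ˡ⁺ {k} a b h s (suc j) = subst (λ i → part b i ≤ part a j) (+-suc j k) (s j)

Above-∷ˡ⁻ : ∀ {k n} a b → Above k (n ∷ a) b → Above (suc k) a b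
Above-∷ˡ⁻ {k} a b s j = subst (λ i → part b i ≤ part a j) (sym (+-suc j k)) (s (suc j))

Above-∷ʳ⁺ : ∀ {k n} d a → Above k d a → Above (suc k) d (n ∷ a)
Above-∷ʳ⁺ {k} {n} d a s j = subst (λ i → part (n ∷ a) i ≤ part d j) (sym (+-suc j k)) (s j)

Above-∷ʳ⁻ : ∀ {k n} d a → Above (suc k) d (n ∷ a) → Above k d a
Above-∷ʳ⁻ {k} {n} d a s j = subst (λ i → part (n ∷ a) i ≤ part d j) (+-suc j k) (s j)

rotate : ∀ {p₀ p₁ p₂ p₃ n₀ n₁ n₂ n₃ N k} →
  Counted (Cyl (p₀ ∷ p₁ ∷ p₂ ∷ p₃ ∷ []) (n₀ ∷ n₁ ∷ n₂ ∷ n₃ ∷ []) N) k →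
  Counted (Cyl (p₁ ∷ p₂ ∷ p₃ ∷ p₀ ∷ []) (n₁ ∷ n₂ ∷ n₃ ∷ n₀ ∷ []) N) k
rotate = counted-map f inj
  (λ { (cyl {a = a} {b} {c} {d} A B C D s₁ s₂ s₃ s₀ t) →
         cyl B C D A s₂ s₃ s₀ s₁ (trans (cyc (sum b) (sum c) (sum d) (sum a)) t) })
  (λ { (cyl {a = b} {c} {d} {a} B C D A s₂ s₃ s₀ s₁ t) →
         _ , cyl A B C D s₁ s₂ s₃ s₀ (trans (sym (cyc (sum b) (sum c) (sum d) (sum a))) t) , refl })
  where
  f : Quad → Quad
  f (a ∷ b ∷ c ∷ d ∷ []) = b ∷ c ∷ d ∷ a ∷ []
  inj : ∀ {x y} → f x ≡ f y → x ≡ y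
  inj {_ ∷ _ ∷ _ ∷ _ ∷ []} {_ ∷ _ ∷ _ ∷ _ ∷ []} refl = refl
  cyc : ∀ b c d a → b + (c + (d + (a + 0))) ≡ a + (b + (c + (d + 0)))
  cyc = solve-∀

rotate² : ∀ {p₀ p₁ p₂ p₃ n₀ n₁ n₂ n₃ N k} →
  Counted (Cyl (p₀ ∷ p₁ ∷ p₂ ∷ p₃ ∷ []) (n₀ ∷ n₁ ∷ n₂ ∷ n₃ ∷ []) N) k →
  Counted (Cyl (p₂ ∷ p₃ ∷ p₀ ∷ p₁ ∷ []) (n₂ ∷ n₃ ∷ n₀ ∷ n₁ ∷ []) N) k
rotate² = rotate ∘ rotate

rotate³ : ∀ {p₀ p₁ p₂ p₃ n₀ n₁ n₂ n₃ N k} →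
  Counted (Cyl (p₀ ∷ p₁ ∷ p₂ ∷ p₃ ∷ []) (n₀ ∷ n₁ ∷ n₂ ∷ n₃ ∷ []) N) k →
  Counted (Cyl (p₃ ∷ p₀ ∷ p₁ ∷ p₂ ∷ []) (n₃ ∷ n₀ ∷ n₁ ∷ n₂ ∷ []) N) k
rotate³ = rotate ∘ rotate²

-- Either the largest part of the first component is at most n, or it is n + 1, and removing it
-- moves a unit of the profile from the first position to the second.
module _ {p₀ p₁ p₂ p₃ n n₁ n₂ n₃ : ℕ} (n₁≤ : n₁ ≤ suc n) where
  private
    profile profile′ : Vec ℕ 4
    profile  = suc p₀ ∷ p₁ ∷ p₂ ∷ p₃ ∷ []
    profile′ = p₀ ∷ suc p₁ ∷ p₂ ∷ p₃ ∷ []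
    bound bound⁻ : Vec ℕ 4
    bound    = suc n ∷ n₁ ∷ n₂ ∷ n₃ ∷ []
    bound⁻   = n ∷ n₁ ∷ n₂ ∷ n₃ ∷ []

    head₀ : Quad → ℕ
    head₀ (a ∷ _) = part a 0

    Attained : ℕ → Quad → Set
    Attained N Λ = Cyl profile bound N Λ × head₀ Λ ≡ suc n

    cons : Quad → Quad
    cons (a ∷ Λ) = (suc n ∷ a) ∷ Λ

    cons-injective : ∀ {x y} → cons x ≡ cons y → x ≡ y
    cons-injective {_ ∷ _} {_ ∷ _} refl = refl

    cons⁺ : ∀ {M Λ} → Cyl profile′ bound M Λ → Attained (suc n + M) (cons Λ)
    cons⁺ (cyl {a = a} {b} {d = d} A B@((l , _) , h) C D s₁ s₂ s₃ s₀ t) =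
      cyl (Bounded-∷⁺ A) B C D
          -- The one new inequality is `part b p₁ ≤ suc n`; it holds because the parts of `b` are at
          -- most `n₁`.
          (Above-∷ˡ⁺ a b (≤-trans (part≤head l p₁) (≤-trans h n₁≤)) s₁) s₂ s₃ (Above-∷ʳ⁺ d a s₀)
          (trans (+-assoc (suc n) (sum a) _) (cong (suc n +_) t))
      , refl

    cons⁻ : ∀ {N Λ} → Attained N Λ → ∃ λ Λ′ → Cyl profile′ bound (size Λ′) Λ′ × Λ ≡ cons Λ′ × suc n + size Λ′ ≡ N
    cons⁻ (cyl {a = .(suc n) ∷ a} {b} {d = d} A B C D s₁ s₂ s₃ s₀ t , refl) =
      _ , cyl (Bounded-∷⁻ A) B C D (Above-∷ˡ⁻ a b s₁) s₂ s₃ (Above-∷ʳ⁻ d a s₀) refl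
      , refl , trans (sym (+-assoc (suc n) (sum a) _)) t

    -- Counts are requested only at sizes `M` with `suc n + M ≡ N`, so that they may come from an
    -- induction on the size.
    attained : ∀ {N} {f : PS} → (∀ M → suc n + M ≡ N → Counted (Cyl profile′ bound M) (f M)) →
      Counted (Attained N) ((suc n ↑ f) N)
    attained {N} {f} C with suc n ≤? N
    ... | no  n≰N = counted-≡ (sym (↑-below (suc n) f N (≰⇒> n≰N)))
      (counted-∅ (λ x → let (Λ′ , _ , _ , e) = cons⁻ x in n≰N (subst (suc n ≤_) e (m≤m+n (suc n) _))))
    ... | yes n≤N with N ∸ suc n | m+[n∸m]≡n n≤N
    ...   | M | refl = counted-≡ (sym (↑-shift (suc n) f M))
      (counted-map cons cons-injective cons⁺
        (λ x → let (Λ′ , y , e , s) = cons⁻ x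
               in Λ′ , subst (λ K → Cyl profile′ bound K Λ′) (+-cancelˡ-≡ (suc n) _ _ s) y , e)
        (C M refl))
      where
      ↑-shift : ∀ k f M → (k ↑ f) (k + M) ≡ f M
      ↑-shift zero    f M = refl
      ↑-shift (suc k) f M = ↑-shift k f M

  split : ∀ {N x} {f : PS} → Counted (Cyl profile bound⁻ N) x →
    (∀ M → suc n + M ≡ N → Counted (Cyl profile′ bound M) (f M)) →
    Counted (Cyl profile bound N) (x + (suc n ↑ f) N)
  split C D = counted-⇔
    (λ { (inj₁ (cyl A B C D s₁ s₂ s₃ s₀ t)) → cyl (loosen (n≤1+n n) A) B C D s₁ s₂ s₃ s₀ t
       ; (inj₂ (x , _)) → x })
    cases
    (counted-⊎ (λ { (cyl (_ , h) _ _ _ _ _ _ _ _) (_ , e) → 1+n≰n (subst (_≤ n) e h) })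
      C (attained D))
    where
    cases : ∀ {N Λ} → Cyl profile bound N Λ → Cyl profile bound⁻ N Λ ⊎ Attained N Λ
    cases x@(cyl (p , h) B C D s₁ s₂ s₃ s₀ t) with m≤n⇒m<n∨m≡n h
    ... | inj₁ (s≤s h′) = inj₁ (cyl (p , h′) B C D s₁ s₂ s₃ s₀ t)
    ... | inj₂ e        = inj₂ (x , e)

-- Induction on the bound

all≤ : ℕ → Vec ℕ 4
all≤ n = n ∷ n ∷ n ∷ n ∷ []

profileU profileV profileW : Vec ℕ 4
profileU = 2 ∷ 0 ∷ 0 ∷ 0 ∷ []
profileV = profile1100
profileW = 1 ∷ 0 ∷ 1 ∷ 0 ∷ []

counted-0 : ∀ p N → Counted (Cyl p (all≤ 0) N) (oneS N)
counted-0 (_ ∷ _ ∷ _ ∷ _ ∷ []) zero = counted-singleton ([] ∷ [] ∷ [] ∷ [] ∷ [])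
  (cyl ε ε ε ε (λ _ → z≤n) (λ _ → z≤n) (λ _ → z≤n) (λ _ → z≤n) refl)
  (λ { (cyl A B C D _ _ _ _ _) → empty (Bounded-0 A) (Bounded-0 B) (Bounded-0 C) (Bounded-0 D) })
  where
  ε : Bounded 0 []
  ε = ([] , []) , z≤n
  empty : ∀ {a b c d : List ℕ} → a ≡ [] → b ≡ [] → c ≡ [] → d ≡ [] →
    (a ∷ b ∷ c ∷ d ∷ []) ≡ ([] ∷ [] ∷ [] ∷ [] ∷ [])
  empty refl refl refl refl = refl
counted-0 p (suc N) = counted-∅ absurd
  where
  absurd : ∀ {Λ} → ¬ Cyl p (all≤ 0) (suc N) Λ
  absurd (cyl A B C D _ _ _ _ t)
    with refl ← Bounded-0 A | refl ← Bounded-0 B | refl ← Bounded-0 C | refl ← Bounded-0 D with () ← t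

B-0 : ∀ f → B f 0 ≗ f 0
B-0 f = ∙-identityˡ (f 0)

u-0 : ∀ t → u t 0 ≗ oneS
u-0 t N = trans (B-0 (λ k → (t * k) ↑ e k) N) (↑-exp oneS N (*-zeroʳ t))

module Step (n : ℕ)
  (countU : ∀ N → Counted (Cyl profileU (all≤ n) N) (U n N))
  (countV : ∀ N → Counted (Cyl profileV (all≤ n) N) (V n N))
  (countW : ∀ N → Counted (Cyl profileW (all≤ n) N) (W n N)) where

  x : ℕ
  x = suc n

  n≤x : n ≤ x
  n≤x = n≤1+n n

  -- Series of profile V with second component ≤ n, profile W with first component ≤ n, and profile V with
  -- first component ≤ n, all other parts being ≤ x.
  q′ q r : PS
  q′ = V n ⊕ x ↑ U n
  q  = W n ⊕ x ↑ q′
  r  = V n ⊕ x ↑ q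

  ↑²V : ∀ f N → ((2 * x) ↑ f) N ≡ (x ↑ x ↑ f) N
  ↑²V f N = trans (↑-exp f N (cong (x +_) (+-identityʳ x))) (sym (↑-↑ x x f N))

  ↑U : ∀ N → (x ↑ U x) N ≡ (x ↑ U n) N + (x ↑ x ↑ V x) N
  ↑U N = trans (↑-cong x (U-rec x) N) (↑-⊕ x (U n) (x ↑ V x) N)

  V-rec′ : ∀ N → V x N + (x ↑ x ↑ V x) N ≡ V n N + ((x ↑ W x) N + (x ↑ U x) N)
  V-rec′ N = begin
    V x N + (x ↑ x ↑ V x) N        ≡⟨ cong (V x N +_) (↑²V (V x) N) ⟨
    V x N + ((2 * x) ↑ V x) N      ≡⟨ V-rec x N ⟩
    V n N + (x ↑ (W x ⊕ U x)) N    ≡⟨ cong (V n N +_) (↑-⊕ x (W x) (U x) N) ⟩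
    _                              ∎

  -- Substitute `U-rec` into `V-rec` and cancel `q^{2x} V`. This auxiliary form serves `W≗q`, which
  -- cancels `q^{2x} W` in `W-rec`. Inserting `W≗q` into `V-rec` then yields `V≗r`. The forms `W≗q`
  -- and `V≗r` match what peeling off one entry produces.
  V≗q′ : V x ≗ q′ ⊕ x ↑ W x
  V≗q′ N = +-cancelʳ-≡ ((x ↑ x ↑ V x) N) _ _ (begin
    V x N + (x ↑ x ↑ V x) N                                   ≡⟨ V-rec′ N ⟩
    V n N + ((x ↑ W x) N + (x ↑ U x) N)                       ≡⟨ cong (λ y → V n N + ((x ↑ W x) N + y)) (↑U N) ⟩
    V n N + ((x ↑ W x) N + ((x ↑ U n) N + (x ↑ x ↑ V x) N))
      ≡⟨ rearr (V n N) ((x ↑ W x) N) ((x ↑ U n) N) ((x ↑ x ↑ V x) N) ⟩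
    V n N + (x ↑ U n) N + (x ↑ W x) N + (x ↑ x ↑ V x) N       ∎)
    where
    rearr : ∀ a b c d → a + (b + (c + d)) ≡ a + c + b + d
    rearr = solve-∀

  W≗q : W x ≗ q ⊕ x ↑ V x
  W≗q N = +-cancelʳ-≡ ((x ↑ x ↑ W x) N) _ _ (begin
    W x N + (x ↑ x ↑ W x) N                                   ≡⟨ cong (W x N +_) (↑²V (W x) N) ⟨
    W x N + ((2 * x) ↑ W x) N                                 ≡⟨ W-rec x N ⟩
    W n N + (x ↑ (V x ⊕ V x)) N                               ≡⟨ cong (W n N +_) (↑-⊕ x (V x) (V x) N) ⟩
    W n N + ((x ↑ V x) N + (x ↑ V x) N)
      ≡⟨ cong (λ y → W n N + ((x ↑ V x) N + y)) (trans (↑-cong x V≗q′ N) (↑-⊕ x q′ (x ↑ W x) N)) ⟩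
    W n N + ((x ↑ V x) N + ((x ↑ q′) N + (x ↑ x ↑ W x) N))
      ≡⟨ rearr (W n N) ((x ↑ V x) N) ((x ↑ q′) N) ((x ↑ x ↑ W x) N) ⟩
    W n N + (x ↑ q′) N + (x ↑ V x) N + (x ↑ x ↑ W x) N        ∎)
    where
    rearr : ∀ a b c d → a + (b + (c + d)) ≡ a + c + b + d
    rearr = solve-∀

  V≗r : V x ≗ r ⊕ x ↑ U x
  V≗r N = +-cancelʳ-≡ ((x ↑ x ↑ V x) N) _ _ (begin
    V x N + (x ↑ x ↑ V x) N                                   ≡⟨ V-rec′ N ⟩
    V n N + ((x ↑ W x) N + (x ↑ U x) N)
      ≡⟨ cong (λ y → V n N + (y + (x ↑ U x) N)) (trans (↑-cong x W≗q N) (↑-⊕ x q (x ↑ V x) N)) ⟩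
    V n N + ((x ↑ q) N + (x ↑ x ↑ V x) N + (x ↑ U x) N)
      ≡⟨ rearr (V n N) ((x ↑ q) N) ((x ↑ x ↑ V x) N) ((x ↑ U x) N) ⟩
    V n N + (x ↑ q) N + (x ↑ U x) N + (x ↑ x ↑ V x) N         ∎)
    where
    rearr : ∀ a b c d → a + (b + c + d) ≡ a + b + d + c
    rearr = solve-∀

  -- The zero entries of the profile give `a ≥ b ≥ c ≥ d` partwise, so bounding the first component
  -- bounds all. `looseV` and `looseW` likewise need bounds only at the starts of such chains.
  looseU : ∀ N → Counted (Cyl profileU (n ∷ x ∷ x ∷ x ∷ []) N) (U n N)
  looseU N = counted-⇔
    (λ { (cyl A B C D s₁ s₂ s₃ s₀ t) → cyl A (loosen n≤x B) (loosen n≤x C) (loosen n≤x D) s₁ s₂ s₃ s₀ t })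
    (λ { (cyl A B C D s₁ s₂ s₃ s₀ t) →
         let B′ = tighten A s₁ B; C′ = tighten B′ s₂ C; D′ = tighten C′ s₃ D
         in cyl A B′ C′ D′ s₁ s₂ s₃ s₀ t })
    (countU N)

  looseV : ∀ N → Counted (Cyl profileV (n ∷ n ∷ x ∷ x ∷ []) N) (V n N)
  looseV N = counted-⇔
    (λ { (cyl A B C D s₁ s₂ s₃ s₀ t) → cyl A B (loosen n≤x C) (loosen n≤x D) s₁ s₂ s₃ s₀ t })
    (λ { (cyl A B C D s₁ s₂ s₃ s₀ t) →
         let C′ = tighten B s₂ C; D′ = tighten C′ s₃ D
         in cyl A B C′ D′ s₁ s₂ s₃ s₀ t })
    (countV N)

  looseW : ∀ N → Counted (Cyl profileW (n ∷ x ∷ n ∷ x ∷ []) N) (W n N)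
  looseW N = counted-⇔
    (λ { (cyl A B C D s₁ s₂ s₃ s₀ t) → cyl A (loosen n≤x B) C (loosen n≤x D) s₁ s₂ s₃ s₀ t })
    (λ { (cyl A B C D s₁ s₂ s₃ s₀ t) →
         cyl A (tighten A s₁ B) C (tighten C s₃ D) s₁ s₂ s₃ s₀ t })
    (countW N)

  countQ′ : ∀ N → Counted (Cyl profileV (x ∷ n ∷ x ∷ x ∷ []) N) (q′ N)
  countQ′ N = split n≤x (looseV N) (λ M _ → rotate³ (looseU M))

  countQ : ∀ N → Counted (Cyl profileW (x ∷ x ∷ n ∷ x ∷ []) N) (q N)
  countQ N = split ≤-refl (looseW N) (λ M _ → rotate³ (countQ′ M))

  -- Here the second component is the one peeled: the rotation brings it to the front, and three
  -- more rotations restore the order.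
  countR : ∀ N → Counted (Cyl profileV (n ∷ x ∷ x ∷ x ∷ []) N) (r N)
  countR N = rotate³ (split ≤-refl (rotate (looseV N)) (λ M _ → rotate³ (countQ M)))

  -- Strong induction on the size, with `K` as fuel: a peeled entry `x` is positive. The three
  -- counts are proved together because peeling leads from `U` and `W` to `V`, and from `V` to `U`.
  countUVW : ∀ K N → N < K →
    Counted (Cyl profileU (all≤ x) N) (U x N) ×
    Counted (Cyl profileV (all≤ x) N) (V x N) ×
    Counted (Cyl profileW (all≤ x) N) (W x N)
  countUVW (suc K) N (s≤s N≤K) =
      counted-≡ (sym (U-rec x N)) (split ≤-refl (looseU N) (λ M e → proj₁ (proj₂ (ih M e))))
    , counted-≡ (sym (V≗r N)) (split ≤-refl (countR N) (λ M e → rotate³ (proj₁ (ih M e))))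
    , counted-≡ (sym (W≗q N)) (split ≤-refl (rotate² (countQ N)) (λ M e → rotate³ (proj₁ (proj₂ (ih M e)))))
    where
    ih : ∀ M → x + M ≡ N → _
    ih M e = countUVW K M (≤-trans (subst (suc M ≤_) e (s≤s (m≤n+m M n))) N≤K)

countUVW : ∀ n N →
  Counted (Cyl profileU (all≤ n) N) (U n N) ×
  Counted (Cyl profileV (all≤ n) N) (V n N) ×
  Counted (Cyl profileW (all≤ n) N) (W n N)
countUVW zero N =
    counted-≡ (sym (trans (B-0 (λ j → j ↑ u 1 j) N) (u-0 1 N))) (counted-0 profileU N)
  , counted-≡ (sym (trans (B-0 (u 1) N) (u-0 1 N))) (counted-0 profileV N)
  , counted-≡ (sym (trans (B-0 (u 0) N) (u-0 0 N))) (counted-0 profileW N)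
countUVW (suc n) N = Step.countUVW n
  (λ M → proj₁ (countUVW n M)) (λ M → proj₁ (proj₂ (countUVW n M))) (λ M → proj₂ (proj₂ (countUVW n M)))
  (suc N) N ≤-refl

-- Removing the bound

part₀≤sum : ∀ xs → part xs 0 ≤ sum xs
part₀≤sum []       = z≤n
part₀≤sum (x ∷ xs) = m≤m+n x (sum xs)

Cyl⇒IsCylindric : ∀ {n N Λ} → Cyl profileV (all≤ n) N Λ → IsCylindric profile1100 Λ × size Λ ≡ N
Cyl⇒IsCylindric (cyl A B C D s₁ s₂ s₃ s₀ t) = record
  { partitions = λ { zero → proj₁ A ; (suc zero) → proj₁ B ; (suc (suc zero)) → proj₁ C
                   ; (suc (suc (suc zero))) → proj₁ D }
  ; interlace  = λ { zero → s₁ ; (suc zero) → s₂ ; (suc (suc zero)) → s₃ ; (suc (suc (suc zero))) → s₀ }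
  } , t

-- No part exceeds the total size, so at size N the bound N excludes nothing.
IsCylindric⇒Cyl : ∀ {N Λ} → IsCylindric profile1100 Λ × size Λ ≡ N → Cyl profileV (all≤ N) N Λ
IsCylindric⇒Cyl {Λ = a ∷ b ∷ c ∷ d ∷ []} (C , refl) = cyl
  (partitions zero , ≤-trans (part₀≤sum a) (m≤m+n (sum a) _))
  (partitions (suc zero) , ≤-trans (part₀≤sum b) (≤-trans (m≤m+n (sum b) _) (m≤n+m _ (sum a))))
  (partitions (suc (suc zero)) ,
    ≤-trans (part₀≤sum c) (≤-trans (m≤m+n (sum c) _) (≤-trans (m≤n+m _ (sum b)) (m≤n+m _ (sum a)))))
  (partitions (suc (suc (suc zero))) ,
    ≤-trans (part₀≤sum d) (≤-trans (m≤m+n (sum d) _)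
      (≤-trans (m≤n+m _ (sum c)) (≤-trans (m≤n+m _ (sum b)) (m≤n+m _ (sum a))))))
  (interlace zero) (interlace (suc zero)) (interlace (suc (suc zero))) (interlace (suc (suc (suc zero))))
  refl
  where
  open IsCylindric C

theorem5p6 : (N : ℕ) →
    Σ (List (Vec (List ℕ) 4)) (λ L →
    Unique L
    × All (λ Λ → IsCylindric profile1100 Λ × size Λ ≡ N) L
    × ((Λ : Vec (List ℕ) 4) → IsCylindric profile1100 Λ → size Λ ≡ N → Λ ∈ L)
    × length L ≡ rhs56 N)
theorem5p6 N =
  elements , unique , All.tabulate sound , (λ Λ C s → complete (C , s)) , card
  where
  open Counted (counted-≡ (V-limit N)
    (counted-⇔ Cyl⇒IsCylindric IsCylindric⇒Cyl (proj₁ (proj₂ (countUVW N N)))))
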